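{- Approximating Basic-Summing (with window size $W$ and integer elements in $\{0,1,\dots,R\}$) to within an additive error of $RW\epsilon$ by a deterministic algorithm requires $\Omega\left(\frac1\epsilon+\log W\right)$ bits of memory for $\frac{1}{2W}\le\epsilon\le\frac14$, and $\Omega\left(W\log\frac{1}{W\epsilon}\right)$ bits of memory for $\epsilon\le\frac{1}{2W}$.
   Context: All logarithms are base 2; $W,R\ge1$ are integers and $\epsilon>0$ is real; asymptotics are for $W\to\infty$, with hidden constants independent of $\epsilon$ and $R$. Basic-Summing: given a stream of integers in $\{0,1,\dots,R\}$ arriving one at a time, maintain the sum $S$ of the last $W$ elements (if fewer than $W$ elements have arrived, of all elements so far). A deterministic algorithm using $m$ bits of memory has at most $2^m$ memory configurations, a fixed initial configuration, and a deterministic transition of configuration upon each arriving element; when queried it outputs a real number $\widehat S$ determined by its current configuration. It approximates Basic-Summing to within an additive error of $RW\epsilon$ if $|\widehat S-S|\le RW\epsilon$ for every input stream and at every time.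
   Formalization: The second bound is proved for 1/(2RW) ≤ ε ≤ 1/(2W): without a lower limit on ε it is false, since for R = 1 a W-bit buffer sums exactly for every ε > 0, while W log(1/(Wε)) is unbounded as ε tends to 0. -}

module Defs where

import Algebra.Definitions.RawSemiring
open import Algebra.Properties.Group using (⁻¹-involutive)
open import Data.Empty using (⊥-elim)
open import Data.Fin.Base using (Fin; toℕ)
open import Data.Integer.Base as ℤ using (ℤ; +_; -[1+_])
import Data.Integer.Properties as ℤ
open import Data.List.Base using (map; take; applyDownFrom)
open import Data.Nat.Base as ℕ using (ℕ; zero; suc)
import Data.Nat.Coprimality as Coprimality
open import Data.Nat.ListAction using (sum)
import Data.Nat.Properties as ℕ
open import Data.Product.Base using (∃; ∃-syntax; _×_; _,_)
open import Data.Rational.Base as ℚ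
  using (ℚ; mkℚ; 0ℚ; 1ℚ; ½; _/_; _÷_; ↥_; ↧_; ↧ₙ_; *≤*)
import Data.Rational.Properties as ℚ
import Data.Rational.Unnormalised.Base as ℚᵘ
import Data.Rational.Unnormalised.Properties as ℚᵘ
open import Data.Sum.Base using (_⊎_; inj₁; inj₂; [_,_]′)
open import Function.Bundles using (_↣_)
open import Relation.Binary.PropositionalEquality
open import Relation.Nullary using (¬_; yes; no)

infix  4 _≤_
infix  4 0<_
infixl 6 _+_ _-_
infix  8 -_
infixr 7 _·_ _∙_
infixr 8 _^_ 2^_

_^_ : ℚ → ℕ → ℚ
_^_ = Algebra.Definitions.RawSemiring._^_ ℚ.+-*-rawSemiring

2^_ : ℤ → ℚ
2^ (+ n)    = (+ 2 / 1) ^ n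
2^ -[1+ n ] = ½ ^ suc n

module Lemmas where

  <suc : ∀ q → q ℚ.< q ℚ.+ 1ℚ
  <suc q = subst (ℚ._< q ℚ.+ 1ℚ) (ℚ.+-identityʳ q)
             (ℚ.+-monoʳ-< q (ℚ.positive⁻¹ 1ℚ))

  pred< : ∀ q → q ℚ.- 1ℚ ℚ.< q
  pred< q = subst (q ℚ.- 1ℚ ℚ.<_) (ℚ.+-identityʳ q)
              (ℚ.+-monoʳ-< q (ℚ.negative⁻¹ (ℚ.- 1ℚ)))

  neg-neg : ∀ q → ℚ.- (ℚ.- q) ≡ q
  neg-neg = ⁻¹-involutive ℚ.+-0-group

  sub-add : ∀ p b → (p ℚ.- b) ℚ.+ b ≡ p
  sub-add p b = trans (ℚ.+-assoc p (ℚ.- b) b)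
    (trans (cong (p ℚ.+_) (ℚ.+-inverseˡ b)) (ℚ.+-identityʳ p))

  add-sub : ∀ p b → (p ℚ.+ b) ℚ.- b ≡ p
  add-sub p b = trans (ℚ.+-assoc p b (ℚ.- b))
    (trans (cong (p ℚ.+_) (ℚ.+-inverseʳ b)) (ℚ.+-identityʳ p))

  1^ : ∀ n → 1ℚ ^ n ≡ 1ℚ
  1^ zero    = refl
  1^ (suc n) = trans (ℚ.*-identityˡ (1ℚ ^ n)) (1^ n)

  0<⇒nonNeg : ∀ {a} → 0ℚ ℚ.< a → ℚ.NonNegative a
  0<⇒nonNeg 0<a = ℚ.nonNegative (ℚ.<⇒≤ 0<a)

  ^-pos : ∀ {a} → 0ℚ ℚ.< a → ∀ n → 0ℚ ℚ.< a ^ n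
  ^-pos 0<a zero    = ℚ.positive⁻¹ 1ℚ
  ^-pos {a} 0<a (suc n) = subst (ℚ._< a ℚ.* a ^ n) (ℚ.*-zeroʳ a)
    (ℚ.*-monoʳ-<-pos a {{ℚ.positive 0<a}} (^-pos 0<a n))

  ^-monoˡ-≤ : ∀ {a b} → 0ℚ ℚ.< a → a ℚ.≤ b → ∀ n → a ^ n ℚ.≤ b ^ n
  ^-monoˡ-≤ 0<a a≤b zero = ℚ.≤-refl
  ^-monoˡ-≤ {a} {b} 0<a a≤b (suc n) = ℚ.≤-trans
    (ℚ.*-monoʳ-≤-nonNeg (a ^ n) {{0<⇒nonNeg (^-pos 0<a n)}} a≤b)
    (ℚ.*-monoˡ-≤-nonNeg b {{0<⇒nonNeg (ℚ.<-≤-trans 0<a a≤b)}} (^-monoˡ-≤ 0<a a≤b n))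

  ^-+ : ∀ a m n → a ^ (m ℕ.+ n) ≡ a ^ m ℚ.* a ^ n
  ^-+ a zero    n = sym (ℚ.*-identityˡ (a ^ n))
  ^-+ a (suc m) n = trans (cong (a ℚ.*_) (^-+ a m n)) (sym (ℚ.*-assoc a (a ^ m) (a ^ n)))

  ^-* : ∀ a m n → (a ^ m) ^ n ≡ a ^ (n ℕ.* m)
  ^-* a m zero    = refl
  ^-* a m (suc n) = trans (cong (a ^ m ℚ.*_) (^-* a m n)) (sym (^-+ a m (n ℕ.* m)))

  2ℚ : ℚ
  2ℚ = + 2 / 1

  0<2 : 0ℚ ℚ.< 2ℚ
  0<2 = ℚ.positive⁻¹ 2ℚ

  q<2q : ∀ {q} → 0ℚ ℚ.< q → q ℚ.< 2ℚ ℚ.* q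
  q<2q {q} 0<q = subst (ℚ._< 2ℚ ℚ.* q) (ℚ.*-identityˡ q)
    (ℚ.*-monoˡ-<-pos q {{ℚ.positive 0<q}} (ℚ.<-≤-trans (<suc 1ℚ) ℚ.≤-refl))

  2^-mono-< : ∀ {m n} → m ℕ.< n → 2ℚ ^ m ℚ.< 2ℚ ^ n
  2^-mono-< {m} {suc n} (ℕ.s≤s m≤n) with ℕ.m≤n⇒m<n∨m≡n m≤n
  ... | inj₁ m<n  = ℚ.<-trans (2^-mono-< m<n) (q<2q (^-pos 0<2 n))
  ... | inj₂ refl = q<2q (^-pos 0<2 n)

  1≤2^ : ∀ n → 1ℚ ℚ.≤ 2ℚ ^ n
  1≤2^ zero    = ℚ.≤-refl
  1≤2^ (suc n) = ℚ.<⇒≤ (2^-mono-< (ℕ.s≤s (ℕ.z≤n {n})))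

  nat : ℕ → ℚ
  nat n = mkℚ (+ n) 0 (Coprimality.sym (Coprimality.1-coprimeTo n))

  nat≡ : ∀ n → + n / 1 ≡ nat n
  nat≡ n = ℚ.normalize-coprime (Coprimality.sym (Coprimality.1-coprimeTo n))

  nat-suc : ∀ n → nat (suc n) ≡ 1ℚ ℚ.+ nat n
  nat-suc n = ℚ.toℚᵘ-injective (ℚᵘ.≃-sym (ℚᵘ.≃-trans (ℚ.toℚᵘ-homo-+ 1ℚ (nat n))
    (ℚᵘ.*≡* (cong (ℤ._* + 1) (cong (ℤ._+_ (+ 1)) (ℤ.*-identityʳ (+ n)))))))

  nat≤2^ : ∀ n → nat n ℚ.≤ 2ℚ ^ n
  nat≤2^ zero    = ℚ.<⇒≤ (ℚ.positive⁻¹ 1ℚ)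
  nat≤2^ (suc n) = subst₂ ℚ._≤_ (sym (nat-suc n)) eq (ℚ.+-mono-≤ (1≤2^ n) (nat≤2^ n))
    where
    eq : 2ℚ ^ n ℚ.+ 2ℚ ^ n ≡ 2ℚ ^ suc n
    eq = sym (trans (ℚ.*-distribʳ-+ (2ℚ ^ n) 1ℚ 1ℚ)
      (cong₂ ℚ._+_ (ℚ.*-identityˡ (2ℚ ^ n)) (ℚ.*-identityˡ (2ℚ ^ n))))

  ≤nat : ∀ p → ∃[ n ] p ℚ.≤ nat n
  ≤nat (mkℚ (+ n) d c)    = n , *≤* (subst (ℤ._≤ + n ℤ.* + suc d) refl
    (ℤ.*-monoˡ-≤-nonNeg (+ n) (ℤ.+≤+ (ℕ.s≤s ℕ.z≤n))))
  ≤nat p@(mkℚ -[1+ n ] d c) = 0 , ℚ.<⇒≤ (ℚ.negative⁻¹ p)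

  ≤2^ : ∀ p → ∃[ n ] p ℚ.≤ 2ℚ ^ n
  ≤2^ p with ≤nat p
  ... | n , p≤n = n , ℚ.≤-trans p≤n (nat≤2^ n)

  ½^*2^ : ∀ n → ½ ^ n ℚ.* 2ℚ ^ n ≡ 1ℚ
  ½^*2^ zero = refl
  ½^*2^ (suc n) = begin
    (½ ℚ.* ½ ^ n) ℚ.* (2ℚ ℚ.* 2ℚ ^ n) ≡⟨ ℚ.*-assoc ½ (½ ^ n) _ ⟩
    ½ ℚ.* (½ ^ n ℚ.* (2ℚ ℚ.* 2ℚ ^ n)) ≡⟨ cong (½ ℚ.*_) (sym (ℚ.*-assoc (½ ^ n) 2ℚ _)) ⟩
    ½ ℚ.* (½ ^ n ℚ.* 2ℚ ℚ.* 2ℚ ^ n)   ≡⟨ cong (λ z → ½ ℚ.* (z ℚ.* 2ℚ ^ n)) (ℚ.*-comm (½ ^ n) 2ℚ) ⟩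
    ½ ℚ.* (2ℚ ℚ.* ½ ^ n ℚ.* 2ℚ ^ n)   ≡⟨ cong (½ ℚ.*_) (ℚ.*-assoc 2ℚ (½ ^ n) _) ⟩
    ½ ℚ.* (2ℚ ℚ.* (½ ^ n ℚ.* 2ℚ ^ n)) ≡⟨ cong (λ z → ½ ℚ.* (2ℚ ℚ.* z)) (½^*2^ n) ⟩
    1ℚ ∎
    where open ≡-Reasoning

  ½^≤ : ∀ {a} → 0ℚ ℚ.< a → ∃[ n ] ½ ^ n ℚ.≤ a
  ½^≤ {a} 0<a = n , (begin
    ½ ^ n                     ≡⟨ sym (ℚ.*-identityʳ (½ ^ n)) ⟩
    ½ ^ n ℚ.* 1ℚ              ≡⟨ cong (½ ^ n ℚ.*_) (sym (ℚ.*-inverseˡ a)) ⟩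
    ½ ^ n ℚ.* (ℚ.1/ a ℚ.* a)  ≤⟨ ℚ.*-monoˡ-≤-nonNeg (½ ^ n) {{½^nn}}
                                  (ℚ.*-monoʳ-≤-nonNeg a {{0<⇒nonNeg 0<a}} b≤2^n) ⟩
    ½ ^ n ℚ.* (2ℚ ^ n ℚ.* a)  ≡⟨ sym (ℚ.*-assoc (½ ^ n) (2ℚ ^ n) a) ⟩
    ½ ^ n ℚ.* 2ℚ ^ n ℚ.* a    ≡⟨ cong (ℚ._* a) (½^*2^ n) ⟩
    1ℚ ℚ.* a                  ≡⟨ ℚ.*-identityˡ a ⟩
    a                         ∎)
    where
    open ℚ.≤-Reasoning
    instance
      a≢0 : ℚ.NonZero a
      a≢0 = ℚ.>-nonZero 0<a
    n : ℕ
    n = let (k , _) = ≤2^ (ℚ.1/ a) in k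
    b≤2^n : ℚ.1/ a ℚ.≤ 2ℚ ^ n
    b≤2^n = let (_ , h) = ≤2^ (ℚ.1/ a) in h
    ½^nn : ℚ.NonNegative (½ ^ n)
    ½^nn = 0<⇒nonNeg (^-pos (ℚ.positive⁻¹ ½) n)

  -- n < r and a ≤ 2ⁿ are incompatible with r ≤ log₂ a
  2^-bound : ∀ {n a r} → nat n ℚ.< r → 0ℚ ℚ.< a → a ℚ.≤ 2ℚ ^ n → ¬ (2^ (↥ r) ℚ.≤ a ^ ↧ₙ r)
  2^-bound {n} {a} {mkℚ (+ i) d c} (ℚ.*<* n<r) 0<a a≤ h =
    ℚ.<-irrefl refl (ℚ.<-≤-trans (2^-mono-< dn<i) (ℚ.≤-trans h
      (subst (a ^ suc d ℚ.≤_) (^-* 2ℚ n (suc d)) (^-monoˡ-≤ 0<a a≤ (suc d)))))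
    where
    dn<i : suc d ℕ.* n ℕ.< i
    dn<i = ℤ.drop‿+<+ (subst₂ ℤ._<_
      (trans (sym (ℤ.pos-* n (suc d))) (cong +_ (ℕ.*-comm n (suc d))))
      (ℤ.*-identityʳ (+ i)) n<r)
  2^-bound {n} {a} {mkℚ -[1+ i ] d c} (ℚ.*<* n<r) 0<a a≤ h =
    ℤ.≤⇒≯ (subst (+ 0 ℤ.≤_) (ℤ.pos-* n (suc d)) (ℤ.+≤+ ℕ.z≤n))
      (ℤ.<-trans n<r (subst (ℤ._< + 0) (sym (ℤ.*-identityʳ -[1+ i ])) ℤ.-<+))

  <-1/⇒*-<1 : ∀ {p s} .{{_ : ℚ.NonZero s}} → 0ℚ ℚ.< s → p ℚ.< ℚ.1/ s → p ℚ.* s ℚ.< 1ℚ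
  <-1/⇒*-<1 {p} {s} 0<s h = subst (p ℚ.* s ℚ.<_) (ℚ.*-inverseˡ s)
    (ℚ.*-monoˡ-<-pos s {{ℚ.positive 0<s}} h)

  *-<1⇒<-1/ : ∀ {p s} .{{_ : ℚ.NonZero s}} → 0ℚ ℚ.< s → p ℚ.* s ℚ.< 1ℚ → p ℚ.< ℚ.1/ s
  *-<1⇒<-1/ {p} {s} 0<s h = ℚ.*-cancelʳ-<-nonNeg s {{0<⇒nonNeg 0<s}}
    (subst (p ℚ.* s ℚ.<_) (sym (ℚ.*-inverseˡ s)) h)

  *-÷ : ∀ c a .{{_ : ℚ.NonZero c}} → (a ℚ.* c) ÷ c ≡ a
  *-÷ c a = trans (ℚ.*-assoc a c (ℚ.1/ c))
    (trans (cong (a ℚ.*_) (ℚ.*-inverseʳ c)) (ℚ.*-identityʳ a))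

  ÷-* : ∀ c a .{{_ : ℚ.NonZero c}} → (a ÷ c) ℚ.* c ≡ a
  ÷-* c a = trans (ℚ.*-assoc a (ℚ.1/ c) c)
    (trans (cong (a ℚ.*_) (ℚ.*-inverseˡ c)) (ℚ.*-identityʳ a))

open Lemmas

-- The standard library has no real numbers.  A real number is represented by a
-- Dedekind cut: the set of all rationals strictly below it.

record ℝ : Set₁ where
  field
    Below     : ℚ → Set
    inhabited : ∃ Below
    bounded   : ∃[ q ] ¬ Below q
    closed    : ∀ {p q} → p ℚ.< q → Below q → Below p
    rounded   : ∀ {p} → Below p → ∃[ q ] p ℚ.< q × Below q

  below<bound : ∀ {a p} → Below a → ¬ Below p → a ℚ.< p
  below<bound {a} {p} a∈ p∉ with a ℚ.<? p
  ... | yes a<p = a<p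
  ... | no  a≮p with p ℚ.<? a
  ...   | yes p<a = ⊥-elim (p∉ (closed p<a a∈))
  ...   | no  p≮a = ⊥-elim (p∉ (subst Below (ℚ.≤-antisym (ℚ.≮⇒≥ p≮a) (ℚ.≮⇒≥ a≮p)) a∈))

open ℝ public

_≤_ : ℝ → ℝ → Set
x ≤ y = ∀ q → Below x q → Below y q

0<_ : ℝ → Set
0< x = Below x 0ℚ

fromℚ : ℚ → ℝ
fromℚ r .Below q   = q ℚ.< r
fromℚ r .inhabited = r ℚ.- 1ℚ , pred< r
fromℚ r .bounded   = r , ℚ.<-irrefl refl
fromℚ r .closed    = ℚ.<-trans
fromℚ r .rounded   = ℚ.<-dense

fromℕ : ℕ → ℝ
fromℕ n = fromℚ (+ n / 1)

_+_ : ℝ → ℝ → ℝ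
(x + y) .Below q = ∃[ a ] ∃[ b ] Below x a × Below y b × q ≡ a ℚ.+ b
(x + y) .inhabited with inhabited x | inhabited y
... | a , a∈ | b , b∈ = a ℚ.+ b , a , b , a∈ , b∈ , refl
(x + y) .bounded with bounded x | bounded y
... | p , p∉ | r , r∉ = p ℚ.+ r , λ (a , b , a∈ , b∈ , eq) →
  ℚ.<-irrefl (sym eq) (ℚ.+-mono-< (below<bound x a∈ p∉) (below<bound y b∈ r∉))
(x + y) .closed {p} p<q (a , b , a∈ , b∈ , refl) =
  p ℚ.- b , b ,
  closed x (subst (p ℚ.- b ℚ.<_) (add-sub a b) (ℚ.+-monoˡ-< (ℚ.- b) p<q)) a∈ , b∈ ,
  sym (sub-add p b)
(x + y) .rounded (a , b , a∈ , b∈ , refl) with rounded x a∈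
... | a′ , a<a′ , a′∈ = a′ ℚ.+ b , ℚ.+-monoˡ-< b a<a′ , a′ , b , a′∈ , b∈ , refl

-- q < - x  iff  x ≤ - r for some rational r > q

-_ : ℝ → ℝ
(- x) .Below q = ∃[ r ] q ℚ.< r × ¬ Below x (ℚ.- r)
(- x) .inhabited with bounded x
... | p , p∉ = ℚ.- p ℚ.- 1ℚ , ℚ.- p , pred< (ℚ.- p) , λ h → p∉ (subst (Below x) (neg-neg p) h)
(- x) .bounded with inhabited x
... | a , a∈ = ℚ.- a , λ (r , -a<r , -r∉) →
  -r∉ (closed x (subst (ℚ.- r ℚ.<_) (neg-neg a) (ℚ.neg-antimono-< -a<r)) a∈)
(- x) .closed p<q (r , q<r , -r∉) = r , ℚ.<-trans p<q q<r , -r∉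
(- x) .rounded (r , q<r , -r∉) with ℚ.<-dense q<r
... | s , q<s , s<r = s , q<s , r , s<r , -r∉

_-_ : ℝ → ℝ → ℝ
x - y = x + - y

∣_∣ : ℝ → ℝ
∣ x ∣ .Below q = Below x q ⊎ Below (- x) q
∣ x ∣ .inhabited with inhabited x
... | a , a∈ = a , inj₁ a∈
∣ x ∣ .bounded with bounded x | bounded (- x)
... | p , p∉ | r , r∉ with p ℚ.≤? r
...   | yes p≤r = r , [ (λ r∈ → ℚ.<-irrefl refl (ℚ.<-≤-trans (below<bound x r∈ p∉) p≤r)) , r∉ ]′
...   | no  p≰r = p , [ p∉ , (λ p∈ → p≰r (ℚ.<⇒≤ (below<bound (- x) p∈ r∉))) ]′
∣ x ∣ .closed p<q (inj₁ h) = inj₁ (closed x p<q h)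
∣ x ∣ .closed p<q (inj₂ h) = inj₂ (closed (- x) p<q h)
∣ x ∣ .rounded (inj₁ h) with rounded x h
... | q , p<q , q∈ = q , p<q , inj₁ q∈
∣ x ∣ .rounded (inj₂ h) with rounded (- x) h
... | q , p<q , q∈ = q , p<q , inj₂ q∈

_·_ : (c : ℚ) .{{_ : ℚ.Positive c}} → ℝ → ℝ
_·_ c x = λ where
    .Below q   → Below x (q ÷ c)
    .inhabited → let (a , a∈) = inhabited x in
                 a ℚ.* c , subst (Below x) (sym (*-÷ c a)) a∈
    .bounded   → let (a , a∉) = bounded x in
                 a ℚ.* c , λ h → a∉ (subst (Below x) (*-÷ c a) h)
    .closed p<q → closed x (ℚ.*-monoˡ-<-pos (ℚ.1/ c) {{ℚ.1/pos⇒pos c}} p<q)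
    .rounded {p} h → let (a , p/c<a , a∈) = rounded x h in
                 a ℚ.* c ,
                 subst (ℚ._< a ℚ.* c) (÷-* c p) (ℚ.*-monoˡ-<-pos c p/c<a) ,
                 subst (Below x) (sym (*-÷ c a)) a∈
  where
  instance
    c≢0 : ℚ.NonZero c
    c≢0 = ℚ.pos⇒nonZero c

_∙_ : (n : ℕ) .{{_ : ℕ.NonZero n}} → ℝ → ℝ
n ∙ x = _·_ (+ n / 1) {{ℚ.normalize-pos n 1}} x

-- q < 1 / x  iff  q < 1 / s for some rational s ≥ x

recip : (x : ℝ) → 0< x → ℝ
recip x 0<x = λ where
    .Below q → ∃[ s ] ¬ Below x s × q ℚ.* s ℚ.< 1ℚ
    .inhabited → let (s , s∉) = bounded x in
      0ℚ , s , s∉ , subst (ℚ._< 1ℚ) (sym (ℚ.*-zeroˡ s)) (ℚ.positive⁻¹ 1ℚ)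
    .bounded → let (a , 0<a , a∈) = rounded x 0<x in
      (ℚ.1/ a) {{ℚ.>-nonZero 0<a}} , λ (s , s∉ , h) →
        ℚ.<-asym h (subst (ℚ._< (ℚ.1/ a) {{ℚ.>-nonZero 0<a}} ℚ.* s)
          (ℚ.*-inverseˡ a {{ℚ.>-nonZero 0<a}})
          (ℚ.*-monoʳ-<-pos ((ℚ.1/ a) {{ℚ.>-nonZero 0<a}}) {{ℚ.1/pos⇒pos a {{ℚ.positive 0<a}}}}
            (below<bound x a∈ s∉)))
    .closed p<q (s , s∉ , h) →
      s , s∉ , ℚ.<-trans (ℚ.*-monoˡ-<-pos s {{ℚ.positive (below<bound x 0<x s∉)}} p<q) h
    .rounded {p} (s , s∉ , h) →
      let 0<s = below<bound x 0<x s∉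
          instance s≢0 = ℚ.>-nonZero 0<s
          (q , p<q , q<1/s) = ℚ.<-dense (*-<1⇒<-1/ {p} 0<s h)
      in q , p<q , s , s∉ , <-1/⇒*-<1 0<s q<1/s

-- q < log₂ x  iff  q < r ≤ log₂ a for some rationals r and 0 < a < x,
-- where i / d ≤ log₂ a means 2ⁱ ≤ aᵈ

log₂ : (x : ℝ) → 0< x → ℝ
log₂ x 0<x = λ where
    .Below q → ∃[ r ] q ℚ.< r × ∃[ a ] Below x a × 0ℚ ℚ.< a × 2^ (↥ r) ℚ.≤ a ^ ↧ₙ r
    .inhabited → let (a , 0<a , a∈) = rounded x 0<x
                     (n , h) = ½^≤ 0<a
                 in ℚ.- nat n ℚ.- 1ℚ , ℚ.- nat n , pred< (ℚ.- nat n) , a , a∈ , 0<a , neg-exp n h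
    .bounded → let (p , p∉) = bounded x
                   (n , p≤2^n) = ≤2^ p
               in nat n , λ (r , n<r , a , a∈ , 0<a , h) →
                 2^-bound {n} {a} {r} n<r 0<a (ℚ.≤-trans (ℚ.<⇒≤ (below<bound x a∈ p∉)) p≤2^n) h
    .closed p<q (r , q<r , rest) → r , ℚ.<-trans p<q q<r , rest
    .rounded (r , q<r , rest) → let (s , q<s , s<r) = ℚ.<-dense q<r in
                 s , q<s , r , s<r , rest
  where
  neg-exp : ∀ n {a} → ½ ^ n ℚ.≤ a → 2^ (↥ (ℚ.- nat n)) ℚ.≤ a ^ ↧ₙ (ℚ.- nat n)
  neg-exp zero    {a} h = subst (1ℚ ℚ.≤_) (sym (ℚ.*-identityʳ a)) h
  neg-exp (suc n) {a} h = subst (½ ^ suc n ℚ.≤_) (sym (ℚ.*-identityʳ a)) h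

0<fromℕ : ∀ n .{{_ : ℕ.NonZero n}} → 0< fromℕ n
0<fromℕ n = ℚ.positive⁻¹ (+ n / 1) {{ℚ.normalize-pos n 1}}

0<∙ : ∀ n .{{_ : ℕ.NonZero n}} {x} → 0< x → 0< (n ∙ x)
0<∙ n {x} = subst (Below x)
  (sym (ℚ.*-zeroˡ ((ℚ.1/ (+ n / 1)) {{ℚ.pos⇒nonZero (+ n / 1) {{ℚ.normalize-pos n 1}}}})))

0<recip : ∀ {x} (0<x : 0< x) → 0< recip x 0<x
0<recip {x} 0<x with bounded x
... | s , s∉ = s , s∉ , subst (ℚ._< 1ℚ) (sym (ℚ.*-zeroˡ s)) (ℚ.positive⁻¹ 1ℚ)

-- A deterministic algorithm with m bits of memory reading elements of {0,…,R}

record Algorithm (R m : ℕ) : Set₁ where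
  field
    Config : Set
    memory : Config ↣ Fin (2 ℕ.^ m)
    init   : Config
    step   : Config → Fin (suc R) → Config
    query  : Config → ℝ

open Algorithm public

-- The configuration once the elements s 0 , … , s (t - 1) have arrived

config : ∀ {R m} (A : Algorithm R m) → (ℕ → Fin (suc R)) → ℕ → Config A
config A s zero    = init A
config A s (suc t) = step A (config A s t) (s t)

-- applyDownFrom s t lists the elements that have arrived, the most recent first

windowSum : ∀ {R} → ℕ → (ℕ → Fin (suc R)) → ℕ → ℕ
windowSum W s t = sum (map toℕ (take W (applyDownFrom s t)))

_Approximates_WithinError_ : ∀ {R m} → Algorithm R m → ℕ → ℝ → Set
A Approximates W WithinError e =
  ∀ s t → ∣ query A (config A s t) - fromℕ (windowSum W s t) ∣ ≤ e

module Submission where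

open import Defs
open import Data.Nat.Base using (ℕ; NonZero)
open import Data.Nat.Properties using (m*n≢0)
open import Data.Integer.Base using (+_)
open import Data.Product.Base using (Σ-syntax; ∃-syntax; _×_)
open import Data.Rational.Base using (ℚ; Positive; _/_)
import Data.Nat.Base as ℕ

open Lemmas using (nat; nat≡; neg-neg; *-÷; ÷-*)
open import Data.Fin.Base as Fin using (Fin; zero; suc; toℕ; finToFun; funToFin)
import Data.Fin.Properties as Fin
open import Data.Integer.Base as ℤ using (-[1+_]; +[1+_])
import Data.Integer.Properties as ℤ
open import Data.List.Base using (_∷_; take; applyDownFrom; map)
open import Data.Nat.Base using (zero; suc; z≤n; s≤s; s<s; ⌈_/2⌉; ⌊_/2⌋)
import Data.Nat.Coprimality as Coprimality
open import Data.Nat.DivMod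
  using (m/n*n≤m; m<n*o⇒m/o<n; m≡m%n+[m/n]*n; m%n<n; m≥n⇒m/n>0)
open import Data.Nat.ListAction using (sum)
open import Data.Nat.Properties hiding (m*n≢0)
open import Data.Nat.Tactic.RingSolver using (solve-∀)
open import Data.Product.Base using (_,_; proj₁; proj₂)
open import Data.Rational.Base as ℚ using (mkℚ; 0ℚ; 1ℚ; _÷_; ↥_; ↧ₙ_; *≤*; *<*)
import Data.Rational.Properties as ℚ
open import Data.Rational.Solver using (module +-*-Solver)
import Data.Rational.Unnormalised.Base as ℚᵘ
import Data.Rational.Unnormalised.Properties as ℚᵘ
open import Data.Sum.Base using (inj₁; inj₂)
open import Function.Base using (_∘_; case_of_)
open import Function.Bundles using (Injection)
open import Relation.Binary.Definitions using (tri<; tri≈; tri>)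
open import Relation.Binary.PropositionalEquality
open import Relation.Nullary using (¬_; Dec; contradiction; yes; no)

-- Why the bounds hold.  An algorithm cannot tell apart two streams that reach
-- the same configuration, so it gives both the same answer.  Hence their window
-- sums differ by at most 2RWε (approximation⇒close), and any family of streams
-- that forces larger differences needs pairwise distinct configurations, of
-- which there are at most 2^m.
--
-- Codes.  Encode a word of N letters as a stream of N blocks, each one an element
-- of {0,…,R} repeated b times, followed by zeros.  If two words reach the same
-- configuration after their last block, they keep sharing configurations while
-- zeros arrive, so their sums are close in every later window.  The windows that
-- start at the last block in which the words differ have sums differing by
-- exactly the difference of these blocks.  So if blocks of distinct letters differ
-- by more than 2RWε, the words agree and K^N ≤ 2^m for an alphabet of size K
-- (words≤configs, equispaced-code-bound).
--
-- The term 1/ε: with the letters 0 and R and block length b just above 2Wε there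
-- are N ≥ 1/(8ε) blocks, and 2^N ≤ 2^m (inverse-error-bound).
--
-- The term log W: feed W copies of R, then zeros.  A configuration repeated in
-- the zero phase recurs for ever, also when the window sum is 0.  But while less
-- than half of the window is zeros, the sum is more than RW/2, which is at least
-- 2RWε when ε ≤ 1/4.  So these configurations are distinct, and W ≤ 2^(m+1)
-- (window≤configs, log-window-bound).
--
-- The term W log(1/(Wε)): take blocks of length 2 and letters that are multiples
-- of δ, the least integer above RWε.  Then the alphabet size K satisfies
-- 1/(Wε) ≤ K^3, and K^N ≤ 2^m for N = W/2 rounded down (alphabet-bound).  Length 2
-- rather than 1 keeps K ≥ 2 up to the end point ε = 1/(2W).
--
-- Real numbers.  The conclusions are strict inequalities between rationals, and
-- a rational below recip ε comes with a rational s that is not below ε.  So s can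
-- replace ε throughout (rationalBound), and with s = n/d the rest of the argument
-- takes place in the natural numbers.

private
  variable
    R m : ℕ

+-swap : ∀ p q r → p ℕ.+ (q ℕ.+ r) ≡ q ℕ.+ (p ℕ.+ r)
+-swap = solve-∀

*-swap : ∀ p q r → p ℕ.* (q ℕ.* r) ≡ q ℕ.* (p ℕ.* r)
*-swap = solve-∀

*-swapℚ : ∀ p q r → p ℚ.* (q ℚ.* r) ≡ q ℚ.* (p ℚ.* r)
*-swapℚ = solve 3 (λ p q r → p :* (q :* r) := q :* (p :* r)) refl
  where open +-*-Solver

-- Streams and window sums

-- An infinite input; the element with index 0 arrives first.
Stream : ℕ → Set
Stream R = ℕ → Fin (suc R)

zeros : Stream R
zeros _ = zero

-- prepend b x s is b copies of x followed by s.
prepend : ℕ → Fin (suc R) → Stream R → Stream R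
prepend zero    x s j       = s j
prepend (suc b) x s zero    = x
prepend (suc b) x s (suc j) = prepend b x s j

-- The sum of the first M elements of s.
total : ℕ → Stream R → ℕ
total M s = sum (map toℕ (applyDownFrom s M))

prepend-< : ∀ {b j} (x : Fin (suc R)) s → j ℕ.< b → prepend b x s j ≡ x
prepend-< {b = suc b} {zero}  x s _         = refl
prepend-< {b = suc b} {suc j} x s (s<s j<b) = prepend-< x s j<b

prepend-+ : ∀ b M j (x : Fin (suc R)) s → prepend (b ℕ.+ M) x s (b ℕ.+ j) ≡ prepend M x s j
prepend-+ zero    M j x s = refl
prepend-+ (suc b) M j x s = prepend-+ b M j x s

prepend-drop : ∀ b j (x : Fin (suc R)) s → prepend b x s (b ℕ.+ j) ≡ s j
prepend-drop zero    j x s = refl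
prepend-drop (suc b) j x s = prepend-drop b j x s

prepend-cong : ∀ b (x : Fin (suc R)) {s s′} → (∀ j → s j ≡ s′ j) →
  ∀ j → prepend b x s j ≡ prepend b x s′ j
prepend-cong zero    x eq j       = eq j
prepend-cong (suc b) x eq zero    = refl
prepend-cong (suc b) x eq (suc j) = prepend-cong b x eq j

total-cong : ∀ M {s s′ : Stream R} → (∀ j → s j ≡ s′ j) → total M s ≡ total M s′
total-cong zero    eq = refl
total-cong (suc M) eq = cong₂ ℕ._+_ (cong toℕ (eq M)) (total-cong M eq)

total-zeros : ∀ M → total M (zeros {R}) ≡ 0
total-zeros zero    = refl
total-zeros (suc M) = total-zeros M

total-prepend : ∀ b M (x : Fin (suc R)) s →
  total (M ℕ.+ b) (prepend b x s) ≡ b ℕ.* toℕ x ℕ.+ total M s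
total-prepend b zero x s = trans (go b ≤-refl) (sym (+-identityʳ (b ℕ.* toℕ x)))
  where
  go : ∀ j → j ℕ.≤ b → total j (prepend b x s) ≡ j ℕ.* toℕ x
  go zero    _   = refl
  go (suc j) j<b = cong₂ ℕ._+_ (cong toℕ (prepend-< x s j<b)) (go j (<⇒≤ j<b))
total-prepend b (suc M) x s = begin
  toℕ (prepend b x s (M ℕ.+ b)) ℕ.+ total (M ℕ.+ b) (prepend b x s)
    ≡⟨ cong₂ ℕ._+_ (cong toℕ (trans (cong (prepend b x s) (+-comm M b)) (prepend-drop b M x s)))
                   (total-prepend b M x s) ⟩
  toℕ (s M) ℕ.+ (b ℕ.* toℕ x ℕ.+ total M s)
    ≡⟨ +-swap (toℕ (s M)) (b ℕ.* toℕ x) (total M s) ⟩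
  b ℕ.* toℕ x ℕ.+ (toℕ (s M) ℕ.+ total M s) ∎
  where
  open ≡-Reasoning

-- After W + k elements the window consists of those with index k, …, k + W - 1.
windowSum-full : ∀ W (s : Stream R) k → windowSum W s (W ℕ.+ k) ≡ total W (λ j → s (k ℕ.+ j))
windowSum-full W s k = cong (sum ∘ map toℕ) (go W)
  where
  go : ∀ M → take M (applyDownFrom s (M ℕ.+ k)) ≡ applyDownFrom (λ j → s (k ℕ.+ j)) M
  go zero    = refl
  go (suc M) = cong₂ _∷_ (cong s (+-comm M k)) (go M)

config-agree : (A : Algorithm R m) {s s′ : Stream R} {t t′ : ℕ} →
  config A s t ≡ config A s′ t′ → (∀ k → s (k ℕ.+ t) ≡ s′ (k ℕ.+ t′)) →
  ∀ k → config A s (k ℕ.+ t) ≡ config A s′ (k ℕ.+ t′)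
config-agree A eq agree zero    = eq
config-agree A eq agree (suc k) = cong₂ (step A) (config-agree A eq agree k) (agree k)

-- Encoding words as streams of blocks

module _ {K} (b : ℕ) (letter : Fin K → Fin (suc R)) where

  -- The stream of a word: b copies of each of its letters, then zeros.
  encode : ∀ N → (Fin N → Fin K) → Stream R
  encode zero    w = zeros
  encode (suc N) w = prepend b (letter (w zero)) (encode N (w ∘ suc))

  encode-drop : ∀ N w j → encode N w (N ℕ.* b ℕ.+ j) ≡ zero
  encode-drop zero    w j = refl
  encode-drop (suc N) w j = trans
    (cong (encode (suc N) w) (+-assoc b (N ℕ.* b) j))
    (trans (prepend-drop b (N ℕ.* b ℕ.+ j) _ _) (encode-drop N (w ∘ suc) j))

  encode-cong : ∀ N {u v} → (∀ i → u i ≡ v i) → ∀ j → encode N u j ≡ encode N v j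
  encode-cong zero    eq j = refl
  encode-cong (suc N) {u} {v} eq j = trans
    (cong (λ x → prepend b (letter x) (encode N (u ∘ suc)) j) (eq zero))
    (prepend-cong b (letter (v zero)) (encode-cong N (eq ∘ suc)) j)

  -- If the sums of all windows of two encoded words are related by _≈_, and _≈_
  -- separates blocks of distinct letters within a common context c, then the
  -- words are equal.  By induction the words agree after their first letter, and
  -- then their first blocks are the only difference in the first window.
  decode : ∀ {W} (_≈_ : ℕ → ℕ → Set) → b ℕ.≤ W →
    (∀ {x y} c → (b ℕ.* toℕ (letter x) ℕ.+ c) ≈ (b ℕ.* toℕ (letter y) ℕ.+ c) → x ≡ y) →
    ∀ N u v →
    (∀ k → total W (λ j → encode N u (k ℕ.+ j)) ≈ total W (λ j → encode N v (k ℕ.+ j))) →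
    ∀ i → u i ≡ v i
  decode {W} _≈_ b≤W separated (suc N) u v close = λ where
      zero    → first
      (suc i) → rest i
    where
    u′ = u ∘ suc
    v′ = v ∘ suc

    drop-block : ∀ w k → total W (λ j → encode (suc N) w (b ℕ.+ k ℕ.+ j)) ≡
                         total W (λ j → encode N (w ∘ suc) (k ℕ.+ j))
    drop-block w k = total-cong W λ j → trans
      (cong (encode (suc N) w) (+-assoc b k j)) (prepend-drop b (k ℕ.+ j) _ _)

    rest : ∀ i → u′ i ≡ v′ i
    rest = decode _≈_ b≤W separated N u′ v′ λ k →
      subst₂ _≈_ (drop-block u k) (drop-block v k) (close (b ℕ.+ k))

    first-block : ∀ w → total W (λ j → encode (suc N) w (0 ℕ.+ j)) ≡
                        b ℕ.* toℕ (letter (w zero)) ℕ.+ total (W ℕ.∸ b) (encode N (w ∘ suc))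
    first-block w = trans (cong (λ M → total M (encode (suc N) w)) (sym (m∸n+n≡m b≤W)))
      (total-prepend b (W ℕ.∸ b) _ _)

    first : u zero ≡ v zero
    first = separated _ (subst₂ _≈_ (first-block u)
      (trans (first-block v) (cong (b ℕ.* toℕ (letter (v zero)) ℕ.+_)
        (total-cong (W ℕ.∸ b) λ j → sym (encode-cong N rest j))))
      (close 0))

-- Counting configurations

injection⇒≤ : ∀ {n} (A : Algorithm R m) (f : Fin n → Config A) →
  (∀ {i j} → f i ≡ f j → i ≡ j) → n ℕ.≤ 2 ℕ.^ m
injection⇒≤ A f inj = Fin.injective⇒≤ {f = Injection.to (memory A) ∘ f}
  λ eq → inj (Injection.injective (memory A) eq)

finToFun-injective : ∀ {K N} (i j : Fin (K ℕ.^ N)) →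
  (∀ k → finToFun {K} {N} i k ≡ finToFun {K} {N} j k) → i ≡ j
finToFun-injective {K} {N} i j eq = trans (sym (Fin.funToFin-finToFin {N} {K} i))
  (trans (funToFin-cong N eq) (Fin.funToFin-finToFin {N} {K} j))
  where
  funToFin-cong : ∀ N {f g : Fin N → Fin K} → (∀ k → f k ≡ g k) → funToFin f ≡ funToFin g
  funToFin-cong zero    eq = refl
  funToFin-cong (suc N) eq = cong₂ Fin.combine (eq zero) (funToFin-cong N (eq ∘ suc))

-- Any two streams that lead to the same configuration, possibly at different
-- times, have window sums related by _≈_.
CollisionsClose : Algorithm R m → ℕ → (ℕ → ℕ → Set) → Set
CollisionsClose A W _≈_ = ∀ s t s′ t′ →
  config A s t ≡ config A s′ t′ → windowSum W s t ≈ windowSum W s′ t′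

module _ (A : Algorithm R m) {W} (_≈_ : ℕ → ℕ → Set)
  (same : CollisionsClose A W _≈_)
  where

  -- Distinct words of N letters reach distinct configurations after N blocks:
  -- from a common configuration the zeros that follow lead to common
  -- configurations, so all later window sums are related.
  words≤configs : ∀ {K} b (letter : Fin K → Fin (suc R)) N → b ℕ.≤ W → N ℕ.* b ℕ.≤ W →
    (∀ {x y} c → (b ℕ.* toℕ (letter x) ℕ.+ c) ≈ (b ℕ.* toℕ (letter y) ℕ.+ c) → x ≡ y) →
    K ℕ.^ N ℕ.≤ 2 ℕ.^ m
  words≤configs {K} b letter N b≤W Nb≤W separated =
    injection⇒≤ A (λ i → config A (stream (finToFun i)) (N ℕ.* b)) λ {i} {j} eq →
      finToFun-injective i j (decode b letter _≈_ b≤W separated N _ _ (close _ _ eq))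
    where
    stream : (Fin N → Fin K) → Stream R
    stream = encode b letter N

    stream-end : ∀ w k → stream w (k ℕ.+ N ℕ.* b) ≡ zero
    stream-end w k = trans (cong (stream w) (+-comm k (N ℕ.* b))) (encode-drop b letter N w k)

    close : ∀ u v → config A (stream u) (N ℕ.* b) ≡ config A (stream v) (N ℕ.* b) → ∀ k →
      total W (λ j → stream u (k ℕ.+ j)) ≈ total W (λ j → stream v (k ℕ.+ j))
    close u v eq k = subst₂ _≈_ (windowSum-full W (stream u) k) (windowSum-full W (stream v) k)
      (same _ (W ℕ.+ k) _ (W ℕ.+ k)
        (subst (λ t → config A (stream u) t ≡ config A (stream v) t)
          (m∸n+n≡m (≤-trans Nb≤W (m≤m+n W k)))
          (config-agree A eq (λ i → trans (stream-end u i) (sym (stream-end v i)))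
            (W ℕ.+ k ℕ.∸ N ℕ.* b))))

  -- If sums above RW/2 are not related to 0, then the configurations reached by W
  -- copies of R and then i zeros, for i < W/2, are pairwise distinct.
  window≤configs : (∀ M → W ℕ.< 2 ℕ.* M → ¬ ((M ℕ.* R) ≈ 0)) → W ℕ.≤ 2 ℕ.* 2 ℕ.^ m
  window≤configs far = ≤-trans W≤2H (*-monoʳ-≤ 2 (injection⇒≤ A c (λ {i} {j} → c-injective i j)))
    where
    H = ⌈ W /2⌉

    W≤2H : W ℕ.≤ 2 ℕ.* H
    W≤2H = begin
      W                       ≡⟨ sym (⌊n/2⌋+⌈n/2⌉≡n W) ⟩
      ⌊ W /2⌋ ℕ.+ H           ≤⟨ +-mono-≤ (⌊n/2⌋≤⌈n/2⌉ W) (m≤m+n H 0) ⟩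
      2 ℕ.* H ∎
      where open ≤-Reasoning

    s : Stream R
    s = prepend W (Fin.fromℕ R) zeros

    c : Fin H → Config A
    c i = config A s (W ℕ.+ toℕ i)

    s-end : ∀ k i → s (k ℕ.+ (W ℕ.+ i)) ≡ zero
    s-end k i = trans (cong s (+-swap k W i)) (prepend-drop W (k ℕ.+ i) _ _)

    -- A repeated configuration recurs with period p, as only zeros are arriving.
    recurs : ∀ i p → config A s (W ℕ.+ i) ≡ config A s (W ℕ.+ (p ℕ.+ i)) →
      ∀ k → config A s (W ℕ.+ i) ≡ config A s (W ℕ.+ (k ℕ.* p ℕ.+ i))
    recurs i p eq zero    = refl
    recurs i p eq (suc k) = trans eq (subst₂ (λ a b → config A s a ≡ config A s b)
      (+-swap p W i) (shuffle p W (k ℕ.* p) i)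
      (config-agree A (recurs i p eq k)
        (λ j → trans (s-end j i) (sym (s-end j (k ℕ.* p ℕ.+ i)))) p))
      where
      shuffle : ∀ p q r t → p ℕ.+ (q ℕ.+ (r ℕ.+ t)) ≡ q ℕ.+ (p ℕ.+ r ℕ.+ t)
      shuffle = solve-∀

    sum-after : ∀ i → i ℕ.≤ W → windowSum W s (W ℕ.+ i) ≡ (W ℕ.∸ i) ℕ.* R
    sum-after i i≤W = begin
      windowSum W s (W ℕ.+ i)
        ≡⟨ windowSum-full W s i ⟩
      total W (λ j → s (i ℕ.+ j))
        ≡⟨ total-cong W (λ j → trans
             (cong (λ V → prepend V (Fin.fromℕ R) zeros (i ℕ.+ j)) (sym (m+[n∸m]≡n i≤W)))
             (prepend-+ i (W ℕ.∸ i) j _ _)) ⟩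
      total W (prepend (W ℕ.∸ i) (Fin.fromℕ R) zeros)
        ≡⟨ cong (λ V → total V (prepend (W ℕ.∸ i) (Fin.fromℕ R) zeros)) (sym (m+[n∸m]≡n i≤W)) ⟩
      total (i ℕ.+ (W ℕ.∸ i)) (prepend (W ℕ.∸ i) (Fin.fromℕ R) zeros)
        ≡⟨ total-prepend (W ℕ.∸ i) i _ _ ⟩
      (W ℕ.∸ i) ℕ.* toℕ (Fin.fromℕ R) ℕ.+ total i (zeros {R})
        ≡⟨ cong₂ (λ x y → (W ℕ.∸ i) ℕ.* x ℕ.+ y) (Fin.toℕ-fromℕ R) (total-zeros i) ⟩
      (W ℕ.∸ i) ℕ.* R ℕ.+ 0
        ≡⟨ +-identityʳ _ ⟩
      (W ℕ.∸ i) ℕ.* R ∎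
      where open ≡-Reasoning

    sum-late : ∀ i → windowSum W s (W ℕ.+ (W ℕ.+ i)) ≡ 0
    sum-late i = trans (windowSum-full W s (W ℕ.+ i))
      (trans (total-cong W λ j → trans (cong s (+-comm (W ℕ.+ i) j)) (s-end j i)) (total-zeros W))

    -- The configuration would recur after W further periods, when the window
    -- contains only zeros.
    no-repeat : ∀ (i : Fin H) (j : ℕ) → toℕ i ℕ.< j → c i ≢ config A s (W ℕ.+ j)
    no-repeat i j i<j eq = far (W ℕ.∸ toℕ i) W<2M (subst₂ _≈_ (sum-after (toℕ i) i≤W) late
        (same s _ s _ (recurs (toℕ i) p
          (trans eq (cong (λ t → config A s (W ℕ.+ t)) (sym (m∸n+n≡m (<⇒≤ i<j))))) W)))
      where
      p = j ℕ.∸ toℕ i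
      instance
        p≢0 : NonZero p
        p≢0 = ℕ.>-nonZero (m<n⇒0<n∸m i<j)
      i≤W : toℕ i ℕ.≤ W
      i≤W = ≤-trans (<⇒≤ (Fin.toℕ<n i)) (⌈n/2⌉≤n W)
      late : windowSum W s (W ℕ.+ (W ℕ.* p ℕ.+ toℕ i)) ≡ 0
      late = trans (cong (λ t → windowSum W s (W ℕ.+ t)) (trans
          (cong (ℕ._+ toℕ i) (sym (m+[n∸m]≡n (m≤m*n W p)))) (+-assoc W _ (toℕ i))))
        (sum-late (W ℕ.* p ℕ.∸ W ℕ.+ toℕ i))
      2i<W : suc (toℕ i ℕ.+ toℕ i) ℕ.≤ W
      2i<W = go W (toℕ i) (Fin.toℕ<n i)
        where
        go : ∀ V i → i ℕ.< ⌈ V /2⌉ → suc (i ℕ.+ i) ℕ.≤ V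
        go (suc zero)    zero    _         = s≤s z≤n
        go (suc (suc V)) zero    _         = s≤s z≤n
        go (suc (suc V)) (suc i) (s<s i<h) = s≤s (≤-trans
          (≤-reflexive (cong suc (+-suc i i))) (s≤s (go V i i<h)))
        go (suc zero)    (suc i) (s<s ())
      W<2M : W ℕ.< 2 ℕ.* (W ℕ.∸ toℕ i)
      W<2M = +-cancelʳ-< (toℕ i ℕ.+ toℕ i) W _ (begin-strict
        W ℕ.+ (toℕ i ℕ.+ toℕ i)           <⟨ +-monoʳ-< W 2i<W ⟩
        W ℕ.+ W                           ≡⟨ cong₂ ℕ._+_ e e ⟩
        (M ℕ.+ toℕ i) ℕ.+ (M ℕ.+ toℕ i)   ≡⟨ regroup M (toℕ i) ⟩
        2 ℕ.* M ℕ.+ (toℕ i ℕ.+ toℕ i)     ∎)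
        where
        open ≤-Reasoning
        M = W ℕ.∸ toℕ i
        e : W ≡ M ℕ.+ toℕ i
        e = sym (m∸n+n≡m i≤W)
        regroup : ∀ p q → (p ℕ.+ q) ℕ.+ (p ℕ.+ q) ≡ 2 ℕ.* p ℕ.+ (q ℕ.+ q)
        regroup = solve-∀

    c-injective : ∀ i j → c i ≡ c j → i ≡ j
    c-injective i j eq with Fin.<-cmp i j
    ... | tri< i<j _ _ = contradiction eq (no-repeat i (toℕ j) i<j)
    ... | tri≈ _ i≡j _ = i≡j
    ... | tri> _ _ j<i = contradiction (sym eq) (no-repeat j (toℕ i) j<i)

-- The least multiple of d above Y is d (1 + Y / d); it exceeds Y by at most d.
multiple-above : ∀ d .{{_ : NonZero d}} Y → ∃[ k ] Y ℕ.< d ℕ.* suc k ×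
  d ℕ.* suc k ℕ.≤ Y ℕ.+ d × (∀ {X} → Y ℕ.< X ℕ.* d → suc k ℕ.≤ X)
multiple-above d Y = Y ℕ./ d , lower , upper , m<n*o⇒m/o<n
  where
  open ≤-Reasoning
  lower : Y ℕ.< d ℕ.* suc (Y ℕ./ d)
  lower = begin-strict
    Y                               ≡⟨ m≡m%n+[m/n]*n Y d ⟩
    Y ℕ.% d ℕ.+ (Y ℕ./ d) ℕ.* d     <⟨ +-monoˡ-< _ (m%n<n Y d) ⟩
    d ℕ.+ (Y ℕ./ d) ℕ.* d           ≡⟨ *-comm (suc (Y ℕ./ d)) d ⟩
    d ℕ.* suc (Y ℕ./ d)             ∎
  upper : d ℕ.* suc (Y ℕ./ d) ℕ.≤ Y ℕ.+ d
  upper = begin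
    d ℕ.* suc (Y ℕ./ d)             ≡⟨ *-comm d (suc (Y ℕ./ d)) ⟩
    d ℕ.+ (Y ℕ./ d) ℕ.* d           ≤⟨ +-monoʳ-≤ d (m/n*n≤m Y d) ⟩
    d ℕ.+ Y                         ≡⟨ +-comm d Y ⟩
    Y ℕ.+ d                         ∎

-- The naturals among the rationals

nat-+ : ∀ a b → nat (a ℕ.+ b) ≡ nat a ℚ.+ nat b
nat-+ a b = ℚ.toℚᵘ-injective (ℚᵘ.≃-sym (ℚᵘ.≃-trans (ℚ.toℚᵘ-homo-+ (nat a) (nat b))
  (ℚᵘ.*≡* (cong (ℤ._* + 1) (cong₂ ℤ._+_ (ℤ.*-identityʳ (+ a)) (ℤ.*-identityʳ (+ b)))))))

nat-* : ∀ a b → nat (a ℕ.* b) ≡ nat a ℚ.* nat b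
nat-* a b = ℚ.toℚᵘ-injective (ℚᵘ.≃-sym (ℚᵘ.≃-trans (ℚ.toℚᵘ-homo-* (nat a) (nat b))
  (ℚᵘ.*≡* (cong (ℤ._* + 1) (sym (ℤ.pos-* a b))))))

nat-^ : ∀ a k → nat (a ℕ.^ k) ≡ nat a ^ k
nat-^ a zero    = refl
nat-^ a (suc k) = trans (nat-* a (a ℕ.^ k)) (cong (nat a ℚ.*_) (nat-^ a k))

nat-mono-≤ : ∀ {a b} → a ℕ.≤ b → nat a ℚ.≤ nat b
nat-mono-≤ {a} {b} a≤b = *≤* (subst₂ ℤ._≤_ (sym (ℤ.*-identityʳ (+ a))) (sym (ℤ.*-identityʳ (+ b)))
  (ℤ.+≤+ a≤b))

nat-cancel-≤ : ∀ {a b} → nat a ℚ.≤ nat b → a ℕ.≤ b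
nat-cancel-≤ {a} {b} (*≤* h) =
  ℤ.drop‿+≤+ (subst₂ ℤ._≤_ (ℤ.*-identityʳ (+ a)) (ℤ.*-identityʳ (+ b)) h)

nat-nonNeg : ∀ n → ℚ.NonNegative (nat n)
nat-nonNeg n = ℚ.nonNegative (nat-mono-≤ {0} {n} z≤n)

nat-pos : ∀ n .{{_ : NonZero n}} → ℚ.Positive (nat n)
nat-pos (suc n) = _

denominator*numerator : ∀ n d .{c : Coprimality.Coprime n (suc d)} →
  nat (suc d) ℚ.* mkℚ (+ n) d c ≡ nat n
denominator*numerator n d {c} = ℚ.toℚᵘ-injective
  (ℚᵘ.≃-trans (ℚ.toℚᵘ-homo-* (nat (suc d)) (mkℚ (+ n) d c)) (ℚᵘ.*≡* (begin
    + suc d ℤ.* + n ℤ.* + 1     ≡⟨ ℤ.*-identityʳ _ ⟩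
    + suc d ℤ.* + n             ≡⟨ ℤ.*-comm (+ suc d) (+ n) ⟩
    + n ℤ.* + suc d             ≡⟨ cong (λ k → + n ℤ.* + suc k) (sym (+-identityʳ d)) ⟩
    + n ℤ.* + (suc d ℕ.+ 0)     ∎)))
  where open ≡-Reasoning

nat*unit : ∀ k .{{_ : NonZero k}} → nat k ℚ.* (+ 1 / k) ≡ 1ℚ
nat*unit (suc k) = trans
  (cong (nat (suc k) ℚ.*_) (ℚ.normalize-coprime (Coprimality.1-coprimeTo (suc k))))
  (denominator*numerator 1 k {Coprimality.1-coprimeTo (suc k)})

*-monoˡ-nat : ∀ k {p q} → p ℚ.≤ q → nat k ℚ.* p ℚ.≤ nat k ℚ.* q
*-monoˡ-nat k = ℚ.*-monoˡ-≤-nonNeg (nat k) {{nat-nonNeg k}}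

-- Rational consequences of estimates of real numbers

-- Two halves of p - e ≤ o ≤ p + e, in terms of the rationals below o.  The lower
-- half only gives a doubly negated witness, since the cut of - x is defined by
-- a negation.
estimate-below : ∀ o p {E e a} → ∣ o - fromℚ p ∣ ≤ E → ¬ Below E e → Below o a → a ℚ.≤ p ℚ.+ e
estimate-below o p {E} {e} {a} o-p≤E e∉ a∈ = ℚ.≮⇒≥ λ p+e<a →
  e∉ (o-p≤E e (inj₁ (a , e ℚ.- a , a∈ ,
    (ℚ.- p , subst₂ ℚ._<_ (lhs p e a) (rhs p a) (ℚ.+-monoˡ-< (ℚ.- p ℚ.- a) p+e<a) ,
      ℚ.<-irrefl (neg-neg p)) ,
    split e a)))
  where
  open +-*-Solver
  lhs : ∀ p e a → (p ℚ.+ e) ℚ.+ (ℚ.- p ℚ.- a) ≡ e ℚ.- a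
  lhs = solve 3 (λ p e a → (p :+ e) :+ (:- p :- a) := e :- a) refl
  rhs : ∀ p a → a ℚ.+ (ℚ.- p ℚ.- a) ≡ ℚ.- p
  rhs = solve 2 (λ p a → a :+ (:- p :- a) := :- p) refl
  split : ∀ e a → e ≡ a ℚ.+ (e ℚ.- a)
  split = solve 2 (λ e a → e := a :+ (e :- a)) refl

estimate-above : ∀ o p {E e r} → ∣ o - fromℚ p ∣ ≤ E → ¬ Below E e → e ℚ.< r →
  ¬ ¬ (∃[ a ] Below o a × p ℚ.- r ℚ.< a)
estimate-above o p {E} {e} {r} o-p≤E e∉ e<r none =
  e∉ (o-p≤E e (inj₂ (r , e<r , λ (a , b , a∈ , (r′ , b<r′ , -r′≮p) , -r≡a+b) →
    none (a , a∈ , (begin-strict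
      p ℚ.- r             ≡⟨ cong (p ℚ.+_) -r≡a+b ⟩
      p ℚ.+ (a ℚ.+ b)     <⟨ ℚ.+-monoʳ-< p (ℚ.+-monoʳ-< a b<r′) ⟩
      p ℚ.+ (a ℚ.+ r′)    ≤⟨ ℚ.+-monoˡ-≤ (a ℚ.+ r′) (ℚ.≮⇒≥ -r′≮p) ⟩
      ℚ.- r′ ℚ.+ (a ℚ.+ r′) ≡⟨ cancel a r′ ⟩
      a                   ∎)))))
  where
  open ℚ.≤-Reasoning
  open +-*-Solver
  cancel : ∀ a r → ℚ.- r ℚ.+ (a ℚ.+ r) ≡ a
  cancel = solve 2 (λ a r → :- r :+ (a :+ r) := a) refl

-- Two rationals that are both within E of the same real differ by at most 2E.
common-estimate : ∀ o p p′ E e → ∣ o - fromℚ p ∣ ≤ E → ∣ o - fromℚ p′ ∣ ≤ E → ¬ Below E e →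
  p ℚ.≤ p′ ℚ.+ (e ℚ.+ e)
common-estimate o p p′ E e near near′ e∉ = ℚ.≮⇒≥ λ far →
  estimate-above o p {E} near e∉ (subst₂ ℚ._<_ (lhs p′ e) refl (ℚ.+-monoˡ-< (ℚ.- (p′ ℚ.+ e)) far))
    λ (a , a∈ , p-r<a) → ℚ.<-irrefl refl (ℚ.<-≤-trans p-r<a
      (subst (a ℚ.≤_) (sym (back p p′ e)) (estimate-below o p′ {E} near′ e∉ a∈)))
  where
  open +-*-Solver
  lhs : ∀ p e → p ℚ.+ (e ℚ.+ e) ℚ.- (p ℚ.+ e) ≡ e
  lhs = solve 2 (λ p e → p :+ (e :+ e) :- (p :+ e) := e) refl
  back : ∀ p p′ e → p ℚ.- (p ℚ.- (p′ ℚ.+ e)) ≡ p′ ℚ.+ e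
  back = solve 3 (λ p p′ e → p :- (p :- (p′ :+ e)) := p′ :+ e) refl

-- If t ≥ x, then t n ≥ n x.
above-∙ : ∀ n .{{_ : NonZero n}} x t → ¬ Below x t → ¬ Below (n ∙ x) (t ℚ.* nat n)
above-∙ n x t t∉ h = t∉ (subst (Below x)
  (trans (cong (λ z → (t ℚ.* z) ÷ (+ n / 1)) (sym (nat≡ n))) (*-÷ (+ n / 1) t)) h)
  where
  instance
    n≢0 : ℚ.NonZero (+ n / 1)
    n≢0 = ℚ.pos⇒nonZero (+ n / 1) {{ℚ.normalize-pos n 1}}

-- The rationals below n x are those of the form p n with p below x.
∙-unscale : ∀ n .{{_ : NonZero n}} q → ∃[ p ] p ℚ.* nat n ≡ q × (∀ x → Below (n ∙ x) q ≡ Below x p)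
∙-unscale n q = q ÷ (+ n / 1) ,
  trans (cong ((q ÷ (+ n / 1)) ℚ.*_) (sym (nat≡ n))) (÷-* (+ n / 1) q) , λ _ → refl
  where
  instance
    n≢0 : ℚ.NonZero (+ n / 1)
    n≢0 = ℚ.pos⇒nonZero (+ n / 1) {{ℚ.normalize-pos n 1}}

-- A rational s with ε ≤ s ≤ t and 1/l ≤ s ≤ 1/u, written as a fraction n/d.
record RationalBound (ε : ℝ) (l u : ℕ) (t : ℚ) : Set where
  constructor mkRationalBound
  field
    s       : ℚ
    n d     : ℕ
    n≢0     : NonZero n
    d≢0     : NonZero d
    above   : ¬ Below ε s
    0<s     : 0ℚ ℚ.< s
    s≤t     : s ℚ.≤ t
    ds≡n    : nat d ℚ.* s ≡ nat n
    un≤d    : u ℕ.* n ℕ.≤ d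
    d≤ln    : d ℕ.≤ l ℕ.* n

-- Any rational t ≥ ε yields such an s, namely the smaller of t and 1/u; that
-- 1/l ≤ s follows from 1/l ≤ ε.
rationalBound : ∀ ε l u .{{_ : NonZero l}} .{{_ : NonZero u}} → 0< ε →
  fromℚ (+ 1 / l) ≤ ε → ε ≤ fromℚ (+ 1 / u) → ∀ {t} → ¬ Below ε t → RationalBound ε l u t
rationalBound ε l u ε>0 l≤ε ε≤u {t} t∉ = smaller (t ℚ.≤? + 1 / u)
  where
  go : ∀ s → 0ℚ ℚ.< s → ¬ Below ε s → s ℚ.≤ t → s ℚ.≤ + 1 / u → RationalBound ε l u t
  go s@(mkℚ +[1+ n ] d c) 0<s s∉ s≤t s≤u = mkRationalBound s (suc n) (suc d) _ _ s∉ 0<s s≤t ds≡n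
    (nat-cancel-≤ (begin
      nat (u ℕ.* suc n)                   ≡⟨ trans (nat-* u (suc n)) (cong (nat u ℚ.*_) (sym ds≡n)) ⟩
      nat u ℚ.* (nat (suc d) ℚ.* s)       ≡⟨ *-swapℚ (nat u) (nat (suc d)) s ⟩
      nat (suc d) ℚ.* (nat u ℚ.* s)       ≤⟨ *-monoˡ-nat (suc d) (*-monoˡ-nat u s≤u) ⟩
      nat (suc d) ℚ.* (nat u ℚ.* (+ 1 / u))
        ≡⟨ trans (cong (nat (suc d) ℚ.*_) (nat*unit u)) (ℚ.*-identityʳ _) ⟩
      nat (suc d)                         ∎))
    (nat-cancel-≤ (begin
      nat (suc d)
        ≡⟨ sym (trans (cong (nat (suc d) ℚ.*_) (nat*unit l)) (ℚ.*-identityʳ _)) ⟩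
      nat (suc d) ℚ.* (nat l ℚ.* (+ 1 / l))
        ≤⟨ *-monoˡ-nat (suc d) (*-monoˡ-nat l (ℚ.≮⇒≥ λ s<l → s∉ (l≤ε s s<l))) ⟩
      nat (suc d) ℚ.* (nat l ℚ.* s)       ≡⟨ *-swapℚ (nat (suc d)) (nat l) s ⟩
      nat l ℚ.* (nat (suc d) ℚ.* s)       ≡⟨ sym (trans (nat-* l (suc n)) (cong (nat l ℚ.*_) (sym ds≡n))) ⟩
      nat (l ℕ.* suc n)                   ∎))
    where
    open ℚ.≤-Reasoning
    ds≡n : nat (suc d) ℚ.* s ≡ nat (suc n)
    ds≡n = denominator*numerator (suc n) d {c}
  go (mkℚ (+ 0)    d c) (*<* 0<0) = contradiction 0<0 (ℤ.<-irrefl (ℤ.*-zeroˡ (+ suc d)))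
  go s@(mkℚ -[1+ n ] d c) 0<s = contradiction (ℚ.negative⁻¹ s) (ℚ.<-asym 0<s)

  smaller : Dec (t ℚ.≤ + 1 / u) → RationalBound ε l u t
  smaller (yes t≤u) = go t (below<bound ε ε>0 t∉) t∉ ℚ.≤-refl t≤u
  smaller (no  t≰u) = go (+ 1 / u) (below<bound ε ε>0 u∉) u∉ (ℚ.<⇒≤ (ℚ.≰⇒> t≰u)) ℚ.≤-refl
    where
    u∉ : ¬ Below ε (+ 1 / u)
    u∉ h = ℚ.<-irrefl refl (ε≤u (+ 1 / u) h)

-- If s = n/d with d/n ≤ Q, then a s < 1 gives a < Q.
<-from-fraction : ∀ {n d} a s Q .{{_ : NonZero n}} .{{_ : NonZero d}} →
  nat d ℚ.* s ≡ nat n → d ℕ.≤ Q ℕ.* n → a ℚ.* s ℚ.< 1ℚ → a ℚ.< nat Q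
<-from-fraction {n} {d} a s Q ds≡n d≤Qn as<1 =
  ℚ.*-cancelʳ-<-nonNeg (nat n) {{nat-nonNeg n}} (begin-strict
    a ℚ.* nat n             ≡⟨ cong (a ℚ.*_) (sym ds≡n) ⟩
    a ℚ.* (nat d ℚ.* s)     ≡⟨ *-swapℚ a (nat d) s ⟩
    nat d ℚ.* (a ℚ.* s)     <⟨ ℚ.*-monoʳ-<-pos (nat d) {{nat-pos d}} as<1 ⟩
    nat d ℚ.* 1ℚ            ≡⟨ ℚ.*-identityʳ (nat d) ⟩
    nat d                   ≤⟨ nat-mono-≤ d≤Qn ⟩
    nat (Q ℕ.* n)           ≡⟨ nat-* Q n ⟩
    nat Q ℚ.* nat n         ∎)
  where
  open ℚ.≤-Reasoning

*-<1-shrink : ∀ a {s s′} → 0ℚ ℚ.< s′ → s′ ℚ.≤ s → a ℚ.* s ℚ.< 1ℚ → a ℚ.* s′ ℚ.< 1ℚ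
*-<1-shrink a {s} {s′} 0<s′ s′≤s as<1 with ℚ.≤-total 0ℚ a
... | inj₁ 0≤a = ℚ.≤-<-trans (ℚ.*-monoˡ-≤-nonNeg a {{ℚ.nonNegative 0≤a}} s′≤s) as<1
... | inj₂ a≤0 = ℚ.≤-<-trans
  (subst (a ℚ.* s′ ℚ.≤_) (ℚ.*-zeroˡ s′)
    (ℚ.*-monoʳ-≤-nonNeg s′ {{ℚ.nonNegative (ℚ.<⇒≤ 0<s′)}} a≤0))
  (ℚ.positive⁻¹ 1ℚ)

2^-cancel-≤ : ∀ {a b} → 2 ℕ.^ a ℕ.≤ 2 ℕ.^ b → a ℕ.≤ b
2^-cancel-≤ h = ≮⇒≥ λ b<a → ≤⇒≯ h (^-monoʳ-< 2 ≤-refl b<a)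

-- From r ≤ log a and a < Q it follows that r N ≤ N log Q ≤ M, hence r W ≤ c M.
-- Here r ≤ log a is expressed as 2^i ≤ a^D for r = i/D.
log-bound : ∀ {Q N M} c W {a} r → a ℚ.< nat Q → 0ℚ ℚ.< a → 2^ (↥ r) ℚ.≤ a ^ ↧ₙ r →
  Q ℕ.^ N ℕ.≤ 2 ℕ.^ M → W ℕ.≤ c ℕ.* N → r ℚ.* nat W ℚ.≤ nat (c ℕ.* M)
log-bound {Q} {N} {M} c W {a} r@(mkℚ (+ i) D cop) a<Q 0<a 2^i≤a^D Q^N≤2^M W≤cN =
  ℚ.*-cancelˡ-≤-pos (nat (suc D)) (begin
    nat (suc D) ℚ.* (r ℚ.* nat W)   ≡⟨ sym (ℚ.*-assoc (nat (suc D)) r (nat W)) ⟩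
    nat (suc D) ℚ.* r ℚ.* nat W     ≡⟨ cong (ℚ._* nat W) (denominator*numerator i D {cop}) ⟩
    nat i ℚ.* nat W                 ≡⟨ sym (nat-* i W) ⟩
    nat (i ℕ.* W)                   ≤⟨ nat-mono-≤ iW≤DcM ⟩
    nat (suc D ℕ.* (c ℕ.* M))       ≡⟨ nat-* (suc D) (c ℕ.* M) ⟩
    nat (suc D) ℚ.* nat (c ℕ.* M)   ∎)
  where
  2^i≤Q^D : 2 ℕ.^ i ℕ.≤ Q ℕ.^ suc D
  2^i≤Q^D = nat-cancel-≤ (begin
    nat (2 ℕ.^ i)       ≡⟨ nat-^ 2 i ⟩
    nat 2 ^ i           ≤⟨ 2^i≤a^D ⟩
    a ^ suc D           ≤⟨ Lemmas.^-monoˡ-≤ 0<a (ℚ.<⇒≤ a<Q) (suc D) ⟩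
    nat Q ^ suc D       ≡⟨ sym (nat-^ Q (suc D)) ⟩
    nat (Q ℕ.^ suc D)   ∎)
    where open ℚ.≤-Reasoning
  iN≤MD : i ℕ.* N ℕ.≤ M ℕ.* suc D
  iN≤MD = 2^-cancel-≤ (begin
    2 ℕ.^ (i ℕ.* N)           ≡⟨ sym (^-*-assoc 2 i N) ⟩
    (2 ℕ.^ i) ℕ.^ N           ≤⟨ ^-monoˡ-≤ N 2^i≤Q^D ⟩
    (Q ℕ.^ suc D) ℕ.^ N       ≡⟨ ^-*-assoc Q (suc D) N ⟩
    Q ℕ.^ (suc D ℕ.* N)       ≡⟨ cong (Q ℕ.^_) (*-comm (suc D) N) ⟩
    Q ℕ.^ (N ℕ.* suc D)       ≡⟨ sym (^-*-assoc Q N (suc D)) ⟩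
    (Q ℕ.^ N) ℕ.^ suc D       ≤⟨ ^-monoˡ-≤ (suc D) Q^N≤2^M ⟩
    (2 ℕ.^ M) ℕ.^ suc D       ≡⟨ ^-*-assoc 2 M (suc D) ⟩
    2 ℕ.^ (M ℕ.* suc D)       ∎)
    where open ≤-Reasoning
  iW≤DcM : i ℕ.* W ℕ.≤ suc D ℕ.* (c ℕ.* M)
  iW≤DcM = begin
    i ℕ.* W                   ≤⟨ *-monoʳ-≤ i W≤cN ⟩
    i ℕ.* (c ℕ.* N)           ≡⟨ *-swap i c N ⟩
    c ℕ.* (i ℕ.* N)           ≤⟨ *-monoʳ-≤ c iN≤MD ⟩
    c ℕ.* (M ℕ.* suc D)       ≡⟨ rotate c M (suc D) ⟩
    suc D ℕ.* (c ℕ.* M)       ∎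
    where
    open ≤-Reasoning
    rotate : ∀ p q r → p ℕ.* (q ℕ.* r) ≡ r ℕ.* (p ℕ.* q)
    rotate = solve-∀
  open ℚ.≤-Reasoning
log-bound {M = M} c W r@(mkℚ -[1+ _ ] _ _) _ _ _ _ _ = ℚ.≤-trans
  (subst (r ℚ.* nat W ℚ.≤_) (ℚ.*-zeroˡ (nat W))
    (ℚ.*-monoʳ-≤-nonNeg (nat W) {{nat-nonNeg W}} (ℚ.<⇒≤ (ℚ.negative⁻¹ r))))
  (nat-mono-≤ {0} {c ℕ.* M} z≤n)

-- To show c x ≤ m for c = 1/k, it suffices that all rationals below x are below
-- k m.
·-bound : ∀ c .{{_ : ℚ.Positive c}} k m x → c ℚ.* nat k ≡ 1ℚ →
  (∀ q → Below x q → q ℚ.< nat (k ℕ.* m)) → (c · x) ≤ fromℕ m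
·-bound c k m x ck≡1 x<km q q∈ = begin-strict
  q                                 ≡⟨ sym (÷-* c q) ⟩
  (q ÷ c) ℚ.* c                     <⟨ ℚ.*-monoˡ-<-pos c (x<km (q ÷ c) q∈) ⟩
  nat (k ℕ.* m) ℚ.* c               ≡⟨ cong (ℚ._* c) (nat-* k m) ⟩
  nat k ℚ.* nat m ℚ.* c             ≡⟨ rotate (nat k) (nat m) c ⟩
  c ℚ.* nat k ℚ.* nat m             ≡⟨ cong (ℚ._* nat m) ck≡1 ⟩
  1ℚ ℚ.* nat m                      ≡⟨ ℚ.*-identityˡ (nat m) ⟩
  nat m                             ≡⟨ sym (nat≡ m) ⟩
  + m / 1                           ∎
  where
  open ℚ.≤-Reasoning
  open +-*-Solver
  instance
    c≢0 : ℚ.NonZero c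
    c≢0 = ℚ.pos⇒nonZero c
  rotate : ∀ p q r → p ℚ.* q ℚ.* r ≡ r ℚ.* p ℚ.* q
  rotate = solve 3 (λ p q r → p :* q :* r := r :* p :* q) refl

-- From approximation to closeness of integers

-- S and S′ differ by at most 2Y/d.
_≈⟨_,_⟩_ : ℕ → ℕ → ℕ → ℕ → Set
S ≈⟨ d , Y ⟩ S′ = d ℕ.* ℕ.∣ S - S′ ∣ ℕ.≤ 2 ℕ.* Y

-- Streams with a common configuration share the answer of the algorithm, which is
-- within RWε ≤ RWn/d of both window sums.
approximation⇒close : ∀ {R m W} .{{_ : NonZero W}} .{{_ : NonZero R}} {ε l u t} (A : Algorithm R m) →
  A Approximates W WithinError (R ∙ W ∙ ε) → (B : RationalBound ε l u t) → let open RationalBound B in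
  CollisionsClose A W _≈⟨ d , R ℕ.* (W ℕ.* n) ⟩_
approximation⇒close {R} {m} {W} {ε} A approx B s t s′ t′ eq = case ≤-total S S′ of λ where
    (inj₁ S≤S′) → subst (λ z → d ℕ.* z ℕ.≤ 2 ℕ.* Y) (sym (m≤n⇒∣m-n∣≡n∸m S≤S′))
      (excess S′ S (common-estimate o (+ S′ / 1) (+ S / 1) E e at-S′ at-S e∉))
    (inj₂ S′≤S) → subst (λ z → d ℕ.* z ℕ.≤ 2 ℕ.* Y) (sym (m≤n⇒∣n-m∣≡n∸m S′≤S))
      (excess S S′ (common-estimate o (+ S / 1) (+ S′ / 1) E e at-S at-S′ e∉))
  where
  open RationalBound B using (d; n; ds≡n; above) renaming (s to σ)
  o  = query A (config A s t)
  S  = windowSum W s t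
  S′ = windowSum W s′ t′
  Y  = R ℕ.* (W ℕ.* n)
  E  = R ∙ W ∙ ε
  e  = σ ℚ.* nat W ℚ.* nat R

  e∉ : ¬ Below E e
  e∉ = above-∙ R (W ∙ ε) (σ ℚ.* nat W) (above-∙ W ε σ above)

  at-S : ∣ query A (config A s t) - fromℕ S ∣ ≤ E
  at-S = approx s t

  at-S′ : ∣ query A (config A s t) - fromℕ S′ ∣ ≤ E
  at-S′ = subst (λ c → ∣ query A c - fromℕ S′ ∣ ≤ E) (sym eq) (approx s′ t′)

  de≡Y : nat d ℚ.* e ≡ nat Y
  de≡Y = begin
    nat d ℚ.* (σ ℚ.* nat W ℚ.* nat R)   ≡⟨ rotate (nat d) σ (nat W) (nat R) ⟩
    nat R ℚ.* (nat W ℚ.* (nat d ℚ.* σ)) ≡⟨ cong (λ z → nat R ℚ.* (nat W ℚ.* z)) ds≡n ⟩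
    nat R ℚ.* (nat W ℚ.* nat n)         ≡⟨ cong (nat R ℚ.*_) (sym (nat-* W n)) ⟩
    nat R ℚ.* nat (W ℕ.* n)             ≡⟨ sym (nat-* R (W ℕ.* n)) ⟩
    nat Y                               ∎
    where
    open ≡-Reasoning
    open +-*-Solver
    rotate : ∀ p q r t → p ℚ.* (q ℚ.* r ℚ.* t) ≡ t ℚ.* (r ℚ.* (p ℚ.* q))
    rotate = solve 4 (λ p q r t → p :* (q :* r :* t) := t :* (r :* (p :* q))) refl

  excess : ∀ S S′ → + S / 1 ℚ.≤ + S′ / 1 ℚ.+ (e ℚ.+ e) → d ℕ.* (S ℕ.∸ S′) ℕ.≤ 2 ℕ.* Y
  excess S S′ S≤S′+2e = subst (ℕ._≤ 2 ℕ.* Y) (sym (*-distribˡ-∸ d S S′))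
    (m≤n+o⇒m∸n≤o (d ℕ.* S) (d ℕ.* S′) (nat-cancel-≤ (begin
      nat (d ℕ.* S)                             ≡⟨ nat-* d S ⟩
      nat d ℚ.* nat S
        ≤⟨ *-monoˡ-nat d (subst₂ (λ x y → x ℚ.≤ y ℚ.+ (e ℚ.+ e)) (nat≡ S) (nat≡ S′) S≤S′+2e) ⟩
      nat d ℚ.* (nat S′ ℚ.+ (e ℚ.+ e))          ≡⟨ distrib (nat d) (nat S′) e ⟩
      nat d ℚ.* nat S′ ℚ.+ nat 2 ℚ.* (nat d ℚ.* e)
        ≡⟨ cong₂ (λ x y → x ℚ.+ nat 2 ℚ.* y) (sym (nat-* d S′)) de≡Y ⟩
      nat (d ℕ.* S′) ℚ.+ nat 2 ℚ.* nat Y        ≡⟨ cong (nat (d ℕ.* S′) ℚ.+_) (sym (nat-* 2 Y)) ⟩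
      nat (d ℕ.* S′) ℚ.+ nat (2 ℕ.* Y)          ≡⟨ sym (nat-+ (d ℕ.* S′) (2 ℕ.* Y)) ⟩
      nat (d ℕ.* S′ ℕ.+ 2 ℕ.* Y)                ∎)))
    where
    open ℚ.≤-Reasoning
    open +-*-Solver
    distrib : ∀ p q e → p ℚ.* (q ℚ.+ (e ℚ.+ e)) ≡ p ℚ.* q ℚ.+ nat 2 ℚ.* (p ℚ.* e)
    distrib = solve 3 (λ p q e → p :* (q :+ (e :+ e)) := p :* q :+ con (nat 2) :* (p :* e)) refl

-- Lower bounds in terms of a rational error

-- The alphabet 0, δ, 2δ, …, Lδ: blocks of b copies of distinct letters differ by at
-- least b δ, which is more than 2Y/d.
equispaced-code-bound : ∀ {R m W} d Y (A : Algorithm R m) →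
  CollisionsClose A W _≈⟨ d , Y ⟩_ →
  ∀ b N δ L → b ℕ.≤ W → N ℕ.* b ℕ.≤ W → L ℕ.* δ ℕ.≤ R → 2 ℕ.* Y ℕ.< d ℕ.* (b ℕ.* δ) →
  suc L ℕ.^ N ℕ.≤ 2 ℕ.^ m
equispaced-code-bound {R} d Y A same b N δ L b≤W Nb≤W Lδ≤R far =
  words≤configs A _≈⟨ d , Y ⟩_ same b letter N b≤W Nb≤W separated
  where
  xδ≤R : ∀ x → toℕ x ℕ.* δ ℕ.< suc R
  xδ≤R x = s≤s (≤-trans (*-monoˡ-≤ δ (Fin.toℕ≤pred[n] x)) Lδ≤R)

  letter : Fin (suc L) → Fin (suc R)
  letter x = Fin.fromℕ< (xδ≤R x)

  gap : ∀ x y c → ℕ.∣ b ℕ.* toℕ (letter x) ℕ.+ c - b ℕ.* toℕ (letter y) ℕ.+ c ∣ ≡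
                  b ℕ.* (ℕ.∣ toℕ x - toℕ y ∣ ℕ.* δ)
  gap x y c = begin
    ℕ.∣ b ℕ.* toℕ (letter x) ℕ.+ c - b ℕ.* toℕ (letter y) ℕ.+ c ∣
      ≡⟨ cong₂ (λ p q → ℕ.∣ b ℕ.* p ℕ.+ c - b ℕ.* q ℕ.+ c ∣)
           (Fin.toℕ-fromℕ< (xδ≤R x)) (Fin.toℕ-fromℕ< (xδ≤R y)) ⟩
    ℕ.∣ b ℕ.* (toℕ x ℕ.* δ) ℕ.+ c - b ℕ.* (toℕ y ℕ.* δ) ℕ.+ c ∣
      ≡⟨ cong₂ ℕ.∣_-_∣ (+-comm _ c) (+-comm _ c) ⟩
    ℕ.∣ c ℕ.+ b ℕ.* (toℕ x ℕ.* δ) - c ℕ.+ b ℕ.* (toℕ y ℕ.* δ) ∣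
      ≡⟨ ∣m+n-m+o∣≡∣n-o∣ c _ _ ⟩
    ℕ.∣ b ℕ.* (toℕ x ℕ.* δ) - b ℕ.* (toℕ y ℕ.* δ) ∣
      ≡⟨ sym (*-distribˡ-∣-∣ b _ _) ⟩
    b ℕ.* ℕ.∣ toℕ x ℕ.* δ - toℕ y ℕ.* δ ∣
      ≡⟨ cong (b ℕ.*_) (sym (*-distribʳ-∣-∣ δ (toℕ x) (toℕ y))) ⟩
    b ℕ.* (ℕ.∣ toℕ x - toℕ y ∣ ℕ.* δ) ∎
    where open ≡-Reasoning

  separated : ∀ {x y} c →
    (b ℕ.* toℕ (letter x) ℕ.+ c) ≈⟨ d , Y ⟩ (b ℕ.* toℕ (letter y) ℕ.+ c) → x ≡ y
  separated {x} {y} c close with ℕ.∣ toℕ x - toℕ y ∣ in eq | gap x y c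
  ... | zero  | _  = Fin.toℕ-injective (∣m-n∣≡0⇒m≡n eq)
  ... | suc k | gp = contradiction close (<⇒≱ (begin-strict
    2 ℕ.* Y                         <⟨ far ⟩
    d ℕ.* (b ℕ.* δ)                 ≤⟨ *-monoʳ-≤ d (*-monoʳ-≤ b (m≤m+n δ (k ℕ.* δ))) ⟩
    d ℕ.* (b ℕ.* (suc k ℕ.* δ))     ≡⟨ cong (d ℕ.*_) (sym gp) ⟩
    d ℕ.* ℕ.∣ b ℕ.* toℕ (letter x) ℕ.+ c - b ℕ.* toℕ (letter y) ℕ.+ c ∣ ∎))
    where open ≤-Reasoning

module _ {R m W n d} .{{_ : NonZero R}} .{{_ : NonZero W}} .{{_ : NonZero n}} .{{_ : NonZero d}}
  (A : Algorithm R m)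
  (same : CollisionsClose A W _≈⟨ d , R ℕ.* (W ℕ.* n) ⟩_)
  where

  private
    instance
      Wn≢0 : NonZero (W ℕ.* n)
      Wn≢0 = m*n≢0 W n

  -- m ≥ d/(8n): two letters 0 and R, with block length b the least integer above
  -- 2Wn/d.
  inverse-error-bound : 4 ℕ.* n ℕ.≤ d → d ℕ.≤ 2 ℕ.* W ℕ.* n → d ℕ.≤ 8 ℕ.* m ℕ.* n
  inverse-error-bound 4n≤d d≤2Wn with multiple-above d (2 ℕ.* (W ℕ.* n))
  ... | k , 2Wn<db , db≤2Wn+d , least = ≤-trans d≤8Nn (*-monoˡ-≤ n (*-monoʳ-≤ 8 N≤m))
    where
    open ≤-Reasoning
    b = suc k
    b≤W : b ℕ.≤ W
    b≤W = least (begin-strict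
      2 ℕ.* (W ℕ.* n)     <⟨ *-monoˡ-< (W ℕ.* n) {2} {4} (s≤s (s≤s (s≤s z≤n))) ⟩
      4 ℕ.* (W ℕ.* n)     ≡⟨ *-swap 4 W n ⟩
      W ℕ.* (4 ℕ.* n)     ≤⟨ *-monoʳ-≤ W 4n≤d ⟩
      W ℕ.* d             ∎)
    N = W ℕ./ b
    N≤m : N ℕ.≤ m
    N≤m = 2^-cancel-≤ (equispaced-code-bound d (R ℕ.* (W ℕ.* n)) A same b N R 1 b≤W
      (m/n*n≤m W b) (≤-reflexive (*-identityˡ R)) (begin-strict
      2 ℕ.* (R ℕ.* (W ℕ.* n))   ≡⟨ *-swap 2 R (W ℕ.* n) ⟩
      R ℕ.* (2 ℕ.* (W ℕ.* n))   <⟨ *-monoʳ-< R 2Wn<db ⟩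
      R ℕ.* (d ℕ.* b)           ≡⟨ rotate R d b ⟩
      d ℕ.* (b ℕ.* R)           ∎))
      where
      rotate : ∀ p q r → p ℕ.* (q ℕ.* r) ≡ q ℕ.* (r ℕ.* p)
      rotate = solve-∀
    W≤2Nb : W ℕ.≤ 2 ℕ.* N ℕ.* b
    W≤2Nb = begin
      W                         ≡⟨ m≡m%n+[m/n]*n W b ⟩
      W ℕ.% b ℕ.+ N ℕ.* b       ≤⟨ +-monoˡ-≤ (N ℕ.* b) (<⇒≤ (m%n<n W b)) ⟩
      b ℕ.+ N ℕ.* b             ≤⟨ +-monoˡ-≤ (N ℕ.* b) (m≤n*m b N {{ℕ.>-nonZero (m≥n⇒m/n>0 b≤W)}}) ⟩
      N ℕ.* b ℕ.+ N ℕ.* b       ≡⟨ double N b ⟩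
      2 ℕ.* N ℕ.* b             ∎
      where
      double : ∀ p q → p ℕ.* q ℕ.+ p ℕ.* q ≡ 2 ℕ.* p ℕ.* q
      double = solve-∀
    d≤8Nn : d ℕ.≤ 8 ℕ.* N ℕ.* n
    d≤8Nn = *-cancelˡ-≤ W (begin
      W ℕ.* d                                   ≤⟨ *-monoˡ-≤ d W≤2Nb ⟩
      2 ℕ.* N ℕ.* b ℕ.* d                       ≡⟨ regroup N b d ⟩
      2 ℕ.* N ℕ.* (d ℕ.* b)                     ≤⟨ *-monoʳ-≤ (2 ℕ.* N) db≤2Wn+d ⟩
      2 ℕ.* N ℕ.* (2 ℕ.* (W ℕ.* n) ℕ.+ d)
        ≤⟨ *-monoʳ-≤ (2 ℕ.* N) (+-monoʳ-≤ (2 ℕ.* (W ℕ.* n)) d≤2Wn) ⟩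
      2 ℕ.* N ℕ.* (2 ℕ.* (W ℕ.* n) ℕ.+ 2 ℕ.* W ℕ.* n) ≡⟨ collect N W n ⟩
      W ℕ.* (8 ℕ.* N ℕ.* n)                     ∎)
      where
      regroup : ∀ p q r → 2 ℕ.* p ℕ.* q ℕ.* r ≡ 2 ℕ.* p ℕ.* (r ℕ.* q)
      regroup = solve-∀
      collect : ∀ p q r → 2 ℕ.* p ℕ.* (2 ℕ.* (q ℕ.* r) ℕ.+ 2 ℕ.* q ℕ.* r) ≡ q ℕ.* (8 ℕ.* p ℕ.* r)
      collect = solve-∀

  -- W ≤ 2^(m+1) and W ≥ 3 force m ≥ 1, whence W ≤ 2^(2m).
  log-window-bound : 4 ℕ.* n ℕ.≤ d → 3 ℕ.≤ W → W ℕ.≤ 2 ℕ.^ (2 ℕ.* m)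
  log-window-bound 4n≤d 3≤W = square m (window≤configs A _≈⟨ d , R ℕ.* (W ℕ.* n) ⟩_ same far)
    where
    open ≤-Reasoning
    square : ∀ m → W ℕ.≤ 2 ℕ.* 2 ℕ.^ m → W ℕ.≤ 2 ℕ.^ (2 ℕ.* m)
    square zero    W≤2 = contradiction (≤-trans 3≤W W≤2) (<⇒≱ ≤-refl)
    square (suc m) W≤2^ = ≤-trans W≤2^ (^-monoʳ-≤ 2 {2 ℕ.+ m} (s≤s
      (≤-trans (≤-reflexive (+-comm 1 m)) (+-monoʳ-≤ m (s≤s z≤n)))))
    far : ∀ M → W ℕ.< 2 ℕ.* M → ¬ ((M ℕ.* R) ≈⟨ d , R ℕ.* (W ℕ.* n) ⟩ 0)
    far M W<2M = <⇒≱ (*-cancelˡ-< 2 _ _ (begin-strict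
      2 ℕ.* (2 ℕ.* (R ℕ.* (W ℕ.* n)))         ≡⟨ regroup R W n ⟩
      R ℕ.* (W ℕ.* (4 ℕ.* n))                 ≤⟨ *-monoʳ-≤ R (*-monoʳ-≤ W 4n≤d) ⟩
      R ℕ.* (W ℕ.* d)                         <⟨ *-monoʳ-< R (*-monoˡ-< d W<2M) ⟩
      R ℕ.* (2 ℕ.* M ℕ.* d)                   ≡⟨ collect R M d ⟩
      2 ℕ.* (d ℕ.* (M ℕ.* R))
        ≡⟨ cong (λ z → 2 ℕ.* (d ℕ.* z)) (sym (∣-∣-identityʳ (M ℕ.* R))) ⟩
      2 ℕ.* (d ℕ.* ℕ.∣ M ℕ.* R - 0 ∣)         ∎))
      where
      regroup : ∀ p q r → 2 ℕ.* (2 ℕ.* (p ℕ.* (q ℕ.* r))) ≡ p ℕ.* (q ℕ.* (4 ℕ.* r))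
      regroup = solve-∀
      collect : ∀ p q r → p ℕ.* (2 ℕ.* q ℕ.* r) ≡ 2 ℕ.* (r ℕ.* (q ℕ.* p))
      collect = solve-∀

  -- Blocks of length 2 over the multiples of δ, the least integer above RWn/d.
  -- The alphabet has K ≥ 2 letters, and K ≥ d/(3Wn) as δ ≤ 3RWn/d.  Hence
  -- Q = K^3 ≥ 3K is at least d/(Wn).
  alphabet-bound : 2 ℕ.* W ℕ.* n ℕ.≤ d → d ℕ.≤ 2 ℕ.* (R ℕ.* W) ℕ.* n → 2 ℕ.≤ W →
    ∃[ Q ] d ℕ.≤ Q ℕ.* (n ℕ.* W) × Q ℕ.^ (W ℕ./ 2) ℕ.≤ 2 ℕ.^ (3 ℕ.* m)
  alphabet-bound 2Wn≤d d≤2RWn 2≤W with multiple-above d (R ℕ.* (W ℕ.* n))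
  ... | k , Y<dδ , dδ≤Y+d , least = K ℕ.^ 3 , d≤K³nW , K³^N≤2³ᵐ
    where
    open ≤-Reasoning
    δ = suc k
    Y = R ℕ.* (W ℕ.* n)
    N = W ℕ./ 2
    L = R ℕ./ δ
    K = suc L
    δ≤R : δ ℕ.≤ R
    δ≤R = least (*-monoʳ-< R (begin-strict
      W ℕ.* n         <⟨ m<m*n (W ℕ.* n) 2 ≤-refl ⟩
      W ℕ.* n ℕ.* 2   ≡⟨ *-comm (W ℕ.* n) 2 ⟩
      2 ℕ.* (W ℕ.* n) ≡⟨ sym (*-assoc 2 W n) ⟩
      2 ℕ.* W ℕ.* n   ≤⟨ 2Wn≤d ⟩
      d               ∎))
    K^N≤2^m : K ℕ.^ N ℕ.≤ 2 ℕ.^ m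
    K^N≤2^m = equispaced-code-bound d Y A same 2 N δ L 2≤W (m/n*n≤m W 2) (m/n*n≤m R δ) (begin-strict
      2 ℕ.* Y           <⟨ *-monoʳ-< 2 Y<dδ ⟩
      2 ℕ.* (d ℕ.* δ)   ≡⟨ *-swap 2 d δ ⟩
      d ℕ.* (2 ℕ.* δ)   ∎)
    K³^N≤2³ᵐ : (K ℕ.^ 3) ℕ.^ N ℕ.≤ 2 ℕ.^ (3 ℕ.* m)
    K³^N≤2³ᵐ = begin
      (K ℕ.^ 3) ℕ.^ N     ≡⟨ ^-*-assoc K 3 N ⟩
      K ℕ.^ (3 ℕ.* N)     ≡⟨ cong (K ℕ.^_) (*-comm 3 N) ⟩
      K ℕ.^ (N ℕ.* 3)     ≡⟨ sym (^-*-assoc K N 3) ⟩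
      (K ℕ.^ N) ℕ.^ 3     ≤⟨ ^-monoˡ-≤ 3 K^N≤2^m ⟩
      (2 ℕ.^ m) ℕ.^ 3     ≡⟨ ^-*-assoc 2 m 3 ⟩
      2 ℕ.^ (m ℕ.* 3)     ≡⟨ cong (2 ℕ.^_) (*-comm m 3) ⟩
      2 ℕ.^ (3 ℕ.* m)     ∎
    2≤K : 2 ℕ.≤ K
    2≤K = s≤s (m≥n⇒m/n>0 δ≤R)
    R≤Kδ : R ℕ.≤ K ℕ.* δ
    R≤Kδ = begin
      R                     ≡⟨ m≡m%n+[m/n]*n R δ ⟩
      R ℕ.% δ ℕ.+ L ℕ.* δ   ≤⟨ +-monoˡ-≤ (L ℕ.* δ) (<⇒≤ (m%n<n R δ)) ⟩
      K ℕ.* δ               ∎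
    d≤3KWn : d ℕ.≤ 3 ℕ.* K ℕ.* (n ℕ.* W)
    d≤3KWn = *-cancelˡ-≤ R (begin
      R ℕ.* d                                         ≤⟨ *-monoˡ-≤ d R≤Kδ ⟩
      K ℕ.* δ ℕ.* d                                   ≡⟨ regroup K δ d ⟩
      K ℕ.* (d ℕ.* δ)                                 ≤⟨ *-monoʳ-≤ K dδ≤Y+d ⟩
      K ℕ.* (Y ℕ.+ d)                                 ≤⟨ *-monoʳ-≤ K (+-monoʳ-≤ Y d≤2RWn) ⟩
      K ℕ.* (Y ℕ.+ 2 ℕ.* (R ℕ.* W) ℕ.* n)             ≡⟨ collect K R W n ⟩
      R ℕ.* (3 ℕ.* K ℕ.* (n ℕ.* W))                   ∎)
      where
      regroup : ∀ p q r → p ℕ.* q ℕ.* r ≡ p ℕ.* (r ℕ.* q)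
      regroup = solve-∀
      collect : ∀ p q r t → p ℕ.* (q ℕ.* (r ℕ.* t) ℕ.+ 2 ℕ.* (q ℕ.* r) ℕ.* t) ≡
                            q ℕ.* (3 ℕ.* p ℕ.* (t ℕ.* r))
      collect = solve-∀
    d≤K³nW : d ℕ.≤ K ℕ.^ 3 ℕ.* (n ℕ.* W)
    d≤K³nW = ≤-trans d≤3KWn (*-monoˡ-≤ (n ℕ.* W) (begin
      3 ℕ.* K                 ≤⟨ *-monoˡ-≤ K {3} {4} (s≤s (s≤s (s≤s z≤n))) ⟩
      2 ℕ.* 2 ℕ.* K           ≤⟨ *-monoˡ-≤ K (*-mono-≤ 2≤K 2≤K) ⟩
      K ℕ.* K ℕ.* K           ≡⟨ cube K ⟩
      K ℕ.^ 3                 ∎))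
      where
      cube : ∀ p → p ℕ.* p ℕ.* p ≡ p ℕ.* (p ℕ.* (p ℕ.* 1))
      cube = solve-∀

-- Both ranges of the error

theorem13 : (Σ[ c ∈ ℚ ] Σ[ c>0 ∈ Positive c ] ∃[ W₀ ]
    ((W R : ℕ) .{{_ : NonZero W}} .{{_ : NonZero R}} (ε : ℝ) (ε>0 : 0< ε) →
    W₀ ℕ.≤ W →
    fromℚ ((+ 1 / (2 ℕ.* W)) {{m*n≢0 2 W}}) ≤ ε →
    ε ≤ fromℚ (+ 1 / 4) →
    (m : ℕ) (A : Algorithm R m) →
    A Approximates W WithinError (R ∙ W ∙ ε) →
    _·_ c {{c>0}} (recip ε ε>0 + log₂ (fromℕ W) (0<fromℕ W)) ≤ fromℕ m))
    ×
    (Σ[ c ∈ ℚ ] Σ[ c>0 ∈ Positive c ] ∃[ W₀ ]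
    ((W R : ℕ) .{{_ : NonZero W}} .{{_ : NonZero R}} (ε : ℝ) (ε>0 : 0< ε) →
    W₀ ℕ.≤ W →
    fromℚ ((+ 1 / (2 ℕ.* (R ℕ.* W))) {{m*n≢0 2 (R ℕ.* W) {{_}} {{m*n≢0 R W}}}}) ≤ ε →
    ε ≤ fromℚ ((+ 1 / (2 ℕ.* W)) {{m*n≢0 2 W}}) →
    (m : ℕ) (A : Algorithm R m) →
    A Approximates W WithinError (R ∙ W ∙ ε) →
    let Wε>0 = 0<∙ W {ε} ε>0 in
    _·_ c {{c>0}} (W ∙ log₂ (recip (W ∙ ε) Wε>0) (0<recip {W ∙ ε} Wε>0)) ≤ fromℕ m))
theorem13 = (+ 1 / 10 , _ , 3 , error≥1/2W) , (+ 1 / 9 , _ , 2 , error≤1/2W)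
  where
  error≥1/2W : ∀ W R .{{_ : NonZero W}} .{{_ : NonZero R}} ε (ε>0 : 0< ε) → 3 ℕ.≤ W →
    fromℚ ((+ 1 / (2 ℕ.* W)) {{m*n≢0 2 W}}) ≤ ε → ε ≤ fromℚ (+ 1 / 4) →
    ∀ m (A : Algorithm R m) → A Approximates W WithinError (R ∙ W ∙ ε) →
    ((+ 1 / 10) · (recip ε ε>0 + log₂ (fromℕ W) (0<fromℕ W))) ≤ fromℕ m
  error≥1/2W W R ε ε>0 3≤W l≤ε ε≤u m A approx =
    ·-bound (+ 1 / 10) 10 m (recip ε ε>0 + log₂ (fromℕ W) (0<fromℕ W)) refl
      λ where _ (a , b , (t , t∉ , at<1) , (r , b<r , x , x<W , 0<x , 2^r≤x) , refl) →
                go a b t t∉ at<1 r b<r x x<W 0<x 2^r≤x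
    where
    instance _ = m*n≢0 2 W
    -- 8m bounds 1/ε and 2m bounds log W, whence the constant 1/10.
    go : ∀ a b t → ¬ Below ε t → a ℚ.* t ℚ.< 1ℚ → ∀ r → b ℚ.< r →
      ∀ x → x ℚ.< + W / 1 → 0ℚ ℚ.< x → 2^ (ℚ.↥ r) ℚ.≤ x ^ ℚ.↧ₙ r → a ℚ.+ b ℚ.< nat (10 ℕ.* m)
    go a b t t∉ at<1 r b<r x x<W 0<x 2^r≤x = begin-strict
      a ℚ.+ b                                 <⟨ ℚ.+-mono-< a<8m b<2m ⟩
      nat (8 ℕ.* m) ℚ.+ nat (1 ℕ.* (2 ℕ.* m)) ≡⟨ sym (nat-+ (8 ℕ.* m) (1 ℕ.* (2 ℕ.* m))) ⟩
      nat (8 ℕ.* m ℕ.+ 1 ℕ.* (2 ℕ.* m))       ≡⟨ cong nat (collect m) ⟩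
      nat (10 ℕ.* m)                          ∎
      where
      open ℚ.≤-Reasoning
      collect : ∀ p → 8 ℕ.* p ℕ.+ 1 ℕ.* (2 ℕ.* p) ≡ 10 ℕ.* p
      collect = solve-∀
      B = rationalBound ε (2 ℕ.* W) 4 ε>0 l≤ε ε≤u t∉
      open RationalBound B
      instance
        _ = n≢0
        _ = d≢0
      a<8m : a ℚ.< nat (8 ℕ.* m)
      a<8m = <-from-fraction a s (8 ℕ.* m) ds≡n
        (inverse-error-bound {d = d} A (approximation⇒close A approx B) un≤d d≤ln)
        (*-<1-shrink a 0<s s≤t at<1)
      W^1≤ : W ℕ.^ 1 ℕ.≤ 2 ℕ.^ (2 ℕ.* m)
      W^1≤ = subst (ℕ._≤ 2 ℕ.^ (2 ℕ.* m)) (sym (*-identityʳ W))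
        (log-window-bound {d = d} A (approximation⇒close A approx B) un≤d 3≤W)
      b<2m : b ℚ.< nat (1 ℕ.* (2 ℕ.* m))
      b<2m = ℚ.<-≤-trans b<r (subst (ℚ._≤ nat (1 ℕ.* (2 ℕ.* m))) (ℚ.*-identityʳ r)
        (log-bound {Q = W} {N = 1} {M = 2 ℕ.* m} 1 1 r
          (subst (x ℚ.<_) (nat≡ W) x<W) 0<x 2^r≤x W^1≤ ≤-refl))

  error≤1/2W : ∀ W R .{{_ : NonZero W}} .{{_ : NonZero R}} ε (ε>0 : 0< ε) → 2 ℕ.≤ W →
    fromℚ ((+ 1 / (2 ℕ.* (R ℕ.* W))) {{m*n≢0 2 (R ℕ.* W) {{_}} {{m*n≢0 R W}}}}) ≤ ε →
    ε ≤ fromℚ ((+ 1 / (2 ℕ.* W)) {{m*n≢0 2 W}}) →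
    ∀ m (A : Algorithm R m) → A Approximates W WithinError (R ∙ W ∙ ε) →
    let Wε>0 = 0<∙ W {ε} ε>0 in
    ((+ 1 / 9) · (W ∙ log₂ (recip (W ∙ ε) Wε>0) (0<recip {W ∙ ε} Wε>0))) ≤ fromℕ m
  error≤1/2W W R ε ε>0 2≤W l≤ε ε≤u m A approx =
    ·-bound (+ 1 / 9) 9 m (W ∙ L) refl λ q q∈ →
      let (p , pW≡q , eq) = ∙-unscale W q
      in subst (ℚ._< nat (9 ℕ.* m)) pW≡q (go p (subst (λ X → X) (eq L) q∈))
    where
    instance
      _ = m*n≢0 2 W
      _ = m*n≢0 R W
      _ = m*n≢0 2 (R ℕ.* W)
    Wε>0 = 0<∙ W {ε} ε>0
    L = log₂ (recip (W ∙ ε) Wε>0) (0<recip {W ∙ ε} Wε>0)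
    -- The constant 1/9 is a factor 1/3 from W ≤ 3 N, with N = W / 2 rounded
    -- down, and a factor 1/3 from Q = K^3.
    go : ∀ p → Below L p → p ℚ.* nat W ℚ.< nat (9 ℕ.* m)
    go p (r , p<r , a , (t , t∉ , at<1) , 0<a , 2^r≤a) = begin-strict
      p ℚ.* nat W                 <⟨ ℚ.*-monoˡ-<-pos (nat W) {{nat-pos W}} p<r ⟩
      r ℚ.* nat W
        ≤⟨ log-bound {Q = Q} {N = W ℕ./ 2} {M = 3 ℕ.* m} 3 W r a<Q 0<a 2^r≤a Q^N≤2³ᵐ W≤3N ⟩
      nat (3 ℕ.* (3 ℕ.* m))       ≡⟨ cong nat (sym (*-assoc 3 3 m)) ⟩
      nat (9 ℕ.* m)               ∎
      where
      open ℚ.≤-Reasoning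
      -- t bounds W ε from above, so t/W bounds ε.
      t′ = ∙-unscale W t
      t/W = proj₁ t′
      B = rationalBound ε (2 ℕ.* (R ℕ.* W)) (2 ℕ.* W) ε>0 l≤ε ε≤u {t/W}
        (λ h → t∉ (subst (λ X → X) (sym (proj₂ (proj₂ t′) ε)) h))
      open RationalBound B
      instance
        _ = n≢0
        _ = d≢0
      code = alphabet-bound {d = d} A (approximation⇒close A approx B) un≤d d≤ln 2≤W
      Q = proj₁ code
      Q^N≤2³ᵐ = proj₂ (proj₂ code)
      a<Q : a ℚ.< nat Q
      a<Q = <-from-fraction {n ℕ.* W} {d} a (s ℚ.* nat W) Q {{m*n≢0 n W}}
        (trans (sym (ℚ.*-assoc (nat d) s (nat W)))
          (trans (cong (ℚ._* nat W) ds≡n) (sym (nat-* n W))))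
        (proj₁ (proj₂ code))
        (*-<1-shrink a
          (subst (ℚ._< s ℚ.* nat W) (ℚ.*-zeroˡ (nat W))
            (ℚ.*-monoˡ-<-pos (nat W) {{nat-pos W}} 0<s))
          (subst (s ℚ.* nat W ℚ.≤_) (proj₁ (proj₂ t′))
            (ℚ.*-monoʳ-≤-nonNeg (nat W) {{nat-nonNeg W}} s≤t))
          at<1)
      W≤3N : W ℕ.≤ 3 ℕ.* (W ℕ./ 2)
      W≤3N = let N = W ℕ./ 2 in subst₂ ℕ._≤_ (sym (m≡m%n+[m/n]*n W 2)) (triple N)
        (+-monoˡ-≤ (N ℕ.* 2) (≤-trans (ℕ.s≤s⁻¹ (m%n<n W 2)) (m≥n⇒m/n>0 2≤W)))
        where
        triple : ∀ p → p ℕ.+ p ℕ.* 2 ≡ 3 ℕ.* p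
        triple = solve-∀
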